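{- Let $p\geq 2$ and let $G$ be a finite simple $\{pK_2, \mathrm{HVN}\}$-free graph. Then $\chi(G)\leq f_p(\omega(G))$, where $f_p:\mathbb{N}\to\mathbb{N}$ ($p\geq2$) is defined by: $f_t(1)=1$ for $t\geq 2$; $f_2(2)=3$; $f_2(3)=4$; $f_2(s)=s$ for $s\geq 4$; $f_p(2)=2p-2$ and $f_p(3)=2p^2-3p+4$ for $p\geq 3$; and $f_p(m)=f_{p-1}(m)+2f_{p-1}(m-1)$ for $p\geq 3$, $m\geq 4$.
   Context: $\chi(G)$ is the chromatic number and $\omega(G)$ the clique number of $G$. $pK_2$ is the disjoint union of $p$ edges. HVN is the graph on five vertices consisting of a $K_4$ together with a fifth vertex adjacent to exactly two vertices of the $K_4$ (equivalently the join $(K_1\cup K_2)+K_2$). A graph is $\mathcal{F}$-free if it has no induced subgraph isomorphic to a member of $\mathcal{F}$. -}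

module Defs where

open import Data.Nat using (ℕ; zero; suc; _+_; _*_; _∸_; _≤_)
open import Data.Fin using (Fin; toℕ) renaming (_≟_ to _≟ᶠ_)
open import Data.Bool using (Bool; true; false; not; _∧_; _∨_)
open import Data.Product using (Σ; _×_; _,_)
open import Relation.Binary.PropositionalEquality using (_≡_; _≢_)
open import Relation.Nullary using (¬_)
open import Relation.Nullary.Decidable using (⌊_⌋)
open import Function.Definitions using (Injective)

record Graph (V : Set) : Set where
  field
    Adj : V → V → Bool
open Graph public

IsSimple : {V : Set} → Graph V → Set
IsSimple {V} G = (∀ u v → Adj G u v ≡ Adj G v u) × (∀ u → Adj G u u ≡ false)

InducedSub : {W V : Set} → Graph W → Graph V → Set
InducedSub {W} {V} H G =
  Σ (W → V) λ φ → Injective _≡_ _≡_ φ × (∀ u v → Adj H u v ≡ Adj G (φ u) (φ v))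

Free : {W V : Set} → Graph W → Graph V → Set
Free H G = ¬ InducedSub H G

pK₂ : (p : ℕ) → Graph (Fin p × Fin 2)
pK₂ p = record { Adj = λ { (i , a) (j , b) → ⌊ i ≟ᶠ j ⌋ ∧ not ⌊ a ≟ᶠ b ⌋ } }

-- HVN on Fin 5: K₄ on {0,1,2,3}, vertex 4 adjacent exactly to 0 and 1.
hvnNonEdge : ℕ → ℕ → Bool
hvnNonEdge 2 4 = true
hvnNonEdge 4 2 = true
hvnNonEdge 3 4 = true
hvnNonEdge 4 3 = true
hvnNonEdge _ _ = false

HVN : Graph (Fin 5)
HVN = record { Adj = λ u v → not ⌊ u ≟ᶠ v ⌋ ∧ not (hvnNonEdge (toℕ u) (toℕ v)) }

ProperColouring : {n : ℕ} → Graph (Fin n) → ℕ → Set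
ProperColouring {n} G k =
  Σ (Fin n → Fin k) λ c → ∀ u v → Adj G u v ≡ true → c u ≢ c v

χ≤ : {n : ℕ} → Graph (Fin n) → ℕ → Set
χ≤ G k = ProperColouring G k

HasClique : {n : ℕ} → Graph (Fin n) → ℕ → Set
HasClique {n} G w =
  Σ (Fin w → Fin n) λ φ → Injective _≡_ _≡_ φ ×
    (∀ i j → i ≢ j → Adj G (φ i) (φ j) ≡ true)

CliqueNumber : {n : ℕ} → Graph (Fin n) → ℕ → Set
CliqueNumber G w = HasClique G w × ¬ HasClique G (suc w)

-- The binding function f_p(m) (values for p < 2 or m = 0 are irrelevant; set to 0).
f : ℕ → ℕ → ℕ
f 0 _ = 0
f 1 _ = 0
f (suc (suc p)) 0 = 0
f (suc (suc p)) 1 = 1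
f 2 2 = 3
f 2 3 = 4
f 2 (suc (suc (suc (suc s)))) = suc (suc (suc (suc s)))
f (suc (suc (suc q))) 2 = 2 * suc (suc (suc q)) ∸ 2
f (suc (suc (suc q))) 3 =
  let p = suc (suc (suc q)) in (2 * p * p ∸ 3 * p) + 4
f (suc (suc (suc q))) (suc (suc (suc (suc s)))) =
  f (suc (suc q)) (suc (suc (suc (suc s)))) + 2 * f (suc (suc q)) (suc (suc (suc s)))

{-# OPTIONS --safe #-}

-- For p ≥ 3, sort the vertices by their neighbours in a largest clique. The vertices missed by both ends of
-- an edge of the clique induce no (p-1)K₂, and if the clique has at least four vertices then HVN-freeness
-- leaves only vertices with at most one neighbour, or exactly one non-neighbour, in it. This gives the
-- recursion for f and, when p = 2 and ω ≥ 4, an ω-colouring. It remains to 4-colour the {2K₂, K₄}-free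
-- and the {3K₂, K₃}-free graphs. In a minimal counterexample no vertex has its neighbourhood contained in
-- that of a non-neighbour. Small induced subgraphs B are excluded one after another: either B has vertices
-- u, v with N(u) ⊂ N(v), and every vertex adjacent to u and not to v completes B to a graph with an
-- excluded subgraph; or colouring each vertex by its adjacency to B is proper. The certificates for this
-- were found by computer search. For the first class the pentagon is left, around which
-- the complement looks like a circular-arc graph; for the second the disjoint union of a pentagon and an
-- edge. Both are coloured by hand.
module Submission where

open import Defs
open import Data.Bool using (Bool; true; false; not; _∧_; _∨_; if_then_else_; T)
open import Data.Bool.ListAction using (any; all)
open import Data.Bool.Properties using () renaming (_≟_ to _≟ᵇ_)
open import Data.Empty using (⊥; ⊥-elim)
open import Data.Fin using (Fin; zero; suc; toℕ; fromℕ<) renaming (_≟_ to _≟ᶠ_)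
open import Data.Fin.Properties using (any?; all?; toℕ<n; suc-injective; toℕ-injective; fromℕ<-injective)
open import Data.List using (List; []; _∷_; _++_; map; concatMap; filterᵇ; allFin; length)
open import Data.List.Membership.Propositional using (_∈_; lose)
open import Data.List.Membership.Propositional.Properties using (∈-++⁺ˡ; ∈-++⁺ʳ; ∈-concatMap⁺; ∈-map⁺)
open import Data.List.Relation.Unary.All as All using (All; []; _∷_)
open import Data.List.Relation.Unary.Any using (here; there)
open import Data.Nat using (ℕ; zero; suc; _+_; _*_; _∸_; _≤_; _<_; z≤n; s≤s; _/_; _%_; _≡ᵇ_)
open import Data.Nat.DivMod using (m%n<n)
open import Data.Nat.Properties using (≡⇒≡ᵇ; ≤-refl; ≤-trans; ≤-reflexive; <-≤-trans; <⇒≢; n≤1+n; m≤m+n; m≤n+m; m≤n⇒m≤o+n; m≤n⇒m≤n+o; m+n∸m≡n; +-suc; +-comm; +-cancelˡ-≡; +-mono-≤; +-monoʳ-≤; +-monoʳ-<; *-monoʳ-≤)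
open import Data.Nat.Tactic.RingSolver using (solve-∀)
open import Data.Product using (Σ; _×_; _,_; proj₁; proj₂)
open import Data.Sum using (_⊎_; inj₁; inj₂; [_,_]′)
open import Data.Unit using (⊤; tt)
open import Data.Vec as Vec using (Vec; []; _∷_; lookup)
open import Data.Vec.Properties using (lookup-map; map-∘; map-cong; tabulate∘lookup; tabulate-∘; tabulate-cong) renaming (≡-dec to ≡-decᵛ)
open import Function using (_∘_; case_of_)
open import Function.Definitions using (Injective)
open import Relation.Binary.PropositionalEquality using (_≡_; _≢_; refl; sym; trans; cong; cong₂; subst)
open import Relation.Nullary using (¬_; Dec; yes; no)
open import Relation.Nullary.Decidable using (⌊_⌋; _×-dec_; _⊎-dec_; map′; ¬?; from-yes)

-- The induction assumes that there is no clique on m + 1 vertices, not that there is one on m,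
-- because the sets it descends to may lose cliques. When the m-clique is missing, the bound for m -
-- 1 has to suffice, so the bounds must be monotone in m. This decides the case p = 3, m = 3:
-- splitting around a triangle gives 4 + 2 * 3 + 3 = 13 colours, more than the 12 available for m =
-- 4, whereas splitting around an edge gives 4 + 4 + 4 = 12. The certificates need not be trusted.
-- The possible adjacencies of a further vertex are enumerated by the checker itself, so a faulty
-- certificate can only make the check fail. Around the pentagon, colouring by adjacency is too
-- coarse: only consecutive ones of the ten parts are sure to share a colour, and whole parts would
-- thus take five. The fourth colour suffices because parts are cut according to what their vertices
-- meet elsewhere. Beside the pentagon and an edge the difficulty is similar: the vertices far from
-- the edge use three colours and the neighbours of one end the fourth, so the neighbours of the
-- other end must be spread over the first three.

-- Boolean connectives and list searches

∧-elim : ∀ {a b} → a ∧ b ≡ true → a ≡ true × b ≡ true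
∧-elim {true} {true} _ = refl , refl

∧-intro : ∀ {a b} → a ≡ true → b ≡ true → a ∧ b ≡ true
∧-intro refl refl = refl

∨-elim : ∀ {a b} → a ∨ b ≡ true → a ≡ true ⊎ b ≡ true
∨-elim {true}  _ = inj₁ refl
∨-elim {false} e = inj₂ e

∨-introˡ : ∀ {a b} → a ≡ true → a ∨ b ≡ true
∨-introˡ refl = refl

∨-introʳ : ∀ a {b} → b ≡ true → a ∨ b ≡ true
∨-introʳ true  _ = refl
∨-introʳ false e = e

not-elim : ∀ {a} → not a ≡ true → a ≡ false
not-elim {false} _ = refl

not-false : ∀ {a} → not a ≡ false → a ≡ true
not-false {true} _ = refl

not-intro : ∀ {a} → a ≡ false → not a ≡ true
not-intro refl = refl

true≢false : ∀ {a} → a ≡ true → a ≡ false → ⊥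
true≢false refl ()

≢true⇒false : ∀ {a} → a ≢ true → a ≡ false
≢true⇒false {true}  ne = ⊥-elim (ne refl)
≢true⇒false {false} _  = refl

any-elim : {A : Set} (P : A → Bool) (xs : List A) → any P xs ≡ true → Σ A λ x → x ∈ xs × P x ≡ true
any-elim P (x ∷ xs) e with ∨-elim {P x} e
... | inj₁ p = x , here refl , p
... | inj₂ q with any-elim P xs q
...   | y , y∈ , p = y , there y∈ , p

all-elim : {A : Set} (P : A → Bool) {xs : List A} → all P xs ≡ true → ∀ {x} → x ∈ xs → P x ≡ true
all-elim P e (here refl) = proj₁ (∧-elim e)
all-elim P e (there x∈)  = all-elim P (proj₂ (∧-elim e)) x∈

filterᵇ-elim : {A : Set} (P : A → Bool) (xs : List A) {x : A} → x ∈ filterᵇ P xs → x ∈ xs × P x ≡ true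
filterᵇ-elim P (y ∷ xs) x∈ with P y in eq
filterᵇ-elim P (y ∷ xs) (here refl) | true = here refl , eq
filterᵇ-elim P (y ∷ xs) (there x∈)  | true = let a , b = filterᵇ-elim P xs x∈ in there a , b
filterᵇ-elim P (y ∷ xs) x∈ | false = let a , b = filterᵇ-elim P xs x∈ in there a , b

filterᵇ-intro : {A : Set} (P : A → Bool) {xs : List A} {x : A} → x ∈ xs → P x ≡ true → x ∈ filterᵇ P xs
filterᵇ-intro P {y ∷ xs} x∈ p with P y in eq
filterᵇ-intro P {y ∷ xs} (here refl) p | true = here refl
filterᵇ-intro P {y ∷ xs} (there x∈)  p | true = there (filterᵇ-intro P x∈ p)
filterᵇ-intro P {y ∷ xs} (here refl) p | false = ⊥-elim (true≢false p eq)
filterᵇ-intro P {y ∷ xs} (there x∈)  p | false = filterᵇ-intro P x∈ p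

-- Small graphs and the certificate checker

Row : ℕ → Set
Row = Vec Bool

-- A graph as its triangular adjacency matrix: the newest vertex comes first, has position 0, and its row
-- lists its adjacencies to the older vertices.
infixr 5 _▹_

data Shape : ℕ → Set where
  ∅   : Shape 0
  _▹_ : ∀ {k} → Row k → Shape k → Shape (suc k)

edge : ∀ {k} → Shape k → Fin k → Fin k → Bool
edge (r ▹ s) zero    zero    = false
edge (r ▹ s) zero    (suc j) = lookup r j
edge (r ▹ s) (suc i) zero    = lookup r i
edge (r ▹ s) (suc i) (suc j) = edge s i j

hasClique : {A : Set} → (A → A → Bool) → ℕ → List A → Bool
hasClique E zero    xs       = true
hasClique E (suc q) []       = false
hasClique E (suc q) (x ∷ xs) = hasClique E q (filterᵇ (E x) xs) ∨ hasClique E (suc q) xs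

-- The matching is induced: once an edge `x y` is chosen, only vertices adjacent to neither end
-- remain. The checker relies on soundness alone, since an overlooked matching merely leaves one
-- more row to treat.
hasMatching : {A : Set} → (A → A → Bool) → ℕ → List A → Bool
hasMatching E zero    xs       = true
hasMatching E (suc p) []       = false
hasMatching E (suc p) (x ∷ xs) =
  any (λ y → E x y ∧ hasMatching E p (filterᵇ (λ z → not (E x z) ∧ not (E y z)) xs)) xs
  ∨ hasMatching E (suc p) xs

_==_ : ∀ {k} → Row k → Row k → Bool
[]      == []      = true
(a ∷ r) == (b ∷ t) = (if a then b else not b) ∧ (r == t)

==-sound : ∀ {k} (r t : Row k) → r == t ≡ true → r ≡ t
==-sound []      []      _ = refl
==-sound (true ∷ r)  (true ∷ t)  e = cong (true ∷_) (==-sound r t e)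
==-sound (false ∷ r) (false ∷ t) e = cong (false ∷_) (==-sound r t e)

matches : ∀ {k N} → Shape k → Shape N → Vec (Fin N) k → Bool
matches ∅       s []       = true
matches (r ▹ B) s (p ∷ ps) = (r == Vec.map (edge s p) ps) ∧ matches B s ps

-- Saturation makes decoding total. A wrong digit does no harm, because `matches` compares all
-- adjacencies at the decoded positions.
clamp : ∀ {N} → ℕ → Fin (suc N)
clamp {N}     zero    = zero
clamp {zero}  (suc i) = zero
clamp {suc N} (suc i) = suc (clamp i)

positions : ∀ {N} k → ℕ → Vec (Fin (suc N)) k
positions zero    c = []
positions (suc k) c = clamp (c % 16) ∷ positions k (c / 16)

bitsOf : ∀ k → ℕ → Row k
bitsOf zero    m = []
bitsOf (suc k) m = (m % 2 ≡ᵇ 1) ∷ bitsOf k (m / 2)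

shapeOf : (l : List ℕ) → Shape (length l)
shapeOf []      = ∅
shapeOf (m ∷ l) = bitsOf _ m ▹ shapeOf l

Lemmas : Set
Lemmas = List (Σ ℕ Shape)

-- The index of a lemma, and the positions of its vertices as hexadecimal digits, lowest digit first.
Occurrence : Set
Occurrence = ℕ × ℕ

-- dominated u v os: N(u) ⊂ N(v), and the lemma occurrences os exclude every vertex adjacent to u and not to v.
-- coloured c os os′: the types that survive os are coloured by the hexadecimal digits of c, in the order of
-- rows; os′ excludes the edges between types of the same colour.
data Rule : Set where
  dominated : ℕ → ℕ → List Occurrence → Rule
  coloured  : ℕ → List Occurrence → List Occurrence → Rule

-- The rows of a shape are given as bit masks.
Step : Set
Step = List ℕ × Rule

-- The forbidden graphs are the clique on q + 1 vertices and (p + 1)K₂; a row is refuted if a new vertex with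
-- these adjacencies would belong to one of them.
module Search (q p : ℕ) where

  refutedBy : ∀ {k} → Row k → Shape k → List (Fin k) → Bool
  refutedBy {k} r s N =
    hasClique (edge s) q N ∨
    any (λ a → hasMatching (edge s) p (filterᵇ (λ i → not (lookup r i) ∧ not (edge s a i)) (allFin k))) N

  refuted : ∀ {k} → Row k → Shape k → Bool
  refuted {k} r s = refutedBy r s (filterᵇ (lookup r) (allFin k))

  keep : ∀ {k} → Shape k → Row k → List (Row k)
  keep s m = if refuted m s then [] else m ∷ []

  -- Rows grow from the oldest vertex and are pruned at every newer one: a row refuted on the older
  -- vertices has no extension.
  rows : ∀ {k} → Shape k → List (Row k)
  rows ∅       = [] ∷ []
  rows (r ▹ s) = concatMap (λ m → keep (r ▹ s) (true ∷ m) ++ keep (r ▹ s) (false ∷ m)) (rows s)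

  occurs : ∀ {N} → Lemmas → Shape (suc N) → ℕ → ℕ → Bool
  occurs []            s i       c = false
  occurs ((k , B) ∷ Γ) s zero    c = matches B s (positions k c)
  occurs (_ ∷ Γ)       s (suc i) c = occurs Γ s i c

  covered : ∀ {N} → Lemmas → List Occurrence → Shape (suc N) → Bool
  covered Γ os s = any (λ (i , c) → occurs Γ s i c) os

  types : ∀ {k} → Lemmas → List Occurrence → Shape k → List (Row k)
  types Γ os s = filterᵇ (λ m → not (covered Γ os (m ▹ s))) (rows s)

  colourIn : ∀ {k} → List (Row k) → ℕ → Row k → ℕ
  colourIn []       c m = 0
  -- Reduction modulo 4 keeps the colour in range whatever the certificate contains.
  colourIn (t ∷ ts) c m = if t == m then c % 4 else colourIn ts (c / 16) m

  -- Two types may share a colour if adjacent vertices of these types cannot both be added to `s`: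
  -- the second one gets the row `m′` extended by an adjacency to the first.
  clash : ∀ {k} → Lemmas → List Occurrence → Shape k → Row k × ℕ → Row k × ℕ → Bool
  clash Γ os s (m , a) (m′ , b) =
    not (a ≡ᵇ b) ∨ (refuted (true ∷ m′) (m ▹ s) ∨ covered Γ os ((true ∷ m′) ▹ m ▹ s))

  pairwise : {A : Set} → (A → A → Bool) → List A → Bool
  pairwise P []       = true
  -- Each type is also compared with itself, since different vertices may have the same row.
  pairwise P (x ∷ xs) = all (P x) (x ∷ xs) ∧ pairwise P xs

  checkDominated : ∀ {k} → Lemmas → Shape (suc k) → Fin (suc k) → Fin (suc k) → List Occurrence → Bool
  checkDominated {k} Γ s u v os =
    not (edge s u v) ∧
    -- Configurations may repeat vertices; the witness `w` forces the images of `u` and `v` to be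
    -- distinct.
    (any (λ w → edge s v w ∧ not (edge s u w)) (allFin (suc k)) ∧
     all (λ m → not (lookup m u ∧ not (lookup m v)) ∨ covered Γ os (m ▹ s)) (rows s))

  checkColoured : ∀ {k} → Lemmas → Shape (suc k) → ℕ → List Occurrence → List (Row (suc k)) → Bool
  checkColoured Γ s c os ts = pairwise (clash Γ os s) (map (λ m → m , colourIn ts c m) ts)

  check : Lemmas → ∀ {k} → Shape k → Rule → Bool
  check Γ {zero}  s _ = false
  check Γ {suc k} s (dominated a b os)    = checkDominated Γ s (clamp a) (clamp b) os
  check Γ {suc k} s (coloured c os os′) = checkColoured Γ s c os′ (types Γ os s)

  run : Lemmas → List Step → Bool
  run Γ []              = true
  run Γ ((l , R) ∷ rest) = runWith (shapeOf l)
    where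
      runWith : Shape (length l) → Bool
      runWith s = check Γ s R ∧ run ((_ , s) ∷ Γ) rest

  derive : Lemmas → List Step → Lemmas
  derive Γ []               = Γ
  derive Γ ((l , _) ∷ rest) = derive ((_ , shapeOf l) ∷ Γ) rest

  -- A record, so that conversion checking compares the arguments instead of re-running the check.
  record Checked (Γ : Lemmas) (steps : List Step) : Set where
    constructor checked
    field
      passes : run Γ steps ≡ true

-- Decidable search and counting in finite sets

bool-dec : ∀ a → (a ≡ true) ⊎ (a ≡ false)
bool-dec true  = inj₁ refl
bool-dec false = inj₂ refl

-- Abstract, since unfolding nested searches over Fin (4 + s) is expensive.
abstract
  exists : ∀ {n} → (Fin n → Bool) → Bool
  exists P = ⌊ any? (λ v → P v ≟ᵇ true) ⌋

  exists-elim : ∀ {n} (P : Fin n → Bool) → exists P ≡ true → Σ (Fin n) λ v → P v ≡ true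
  exists-elim P e with any? (λ v → P v ≟ᵇ true)
  ... | yes p = p

  exists-intro : ∀ {n} (P : Fin n → Bool) v → P v ≡ true → exists P ≡ true
  exists-intro P v e with any? (λ v → P v ≟ᵇ true)
  ... | yes _ = refl
  ... | no ¬p = ⊥-elim (¬p (v , e))

not-exists : ∀ {n} (P : Fin n → Bool) → exists P ≡ false → ∀ v → P v ≡ false
not-exists P e v with bool-dec (P v)
... | inj₂ f = f
... | inj₁ t = ⊥-elim (true≢false (exists-intro P v t) e)

count : ∀ {n} → (Fin n → Bool) → ℕ
count {zero}  S = 0
count {suc n} S = (if S zero then 1 else 0) + count (S ∘ suc)

indicator-≤ : ∀ a b → (a ≡ true → b ≡ true) → (if a then 1 else 0) ≤ (if b then 1 else 0)
indicator-≤ true  true  _ = ≤-refl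
indicator-≤ true  false h = ⊥-elim (true≢false (h refl) refl)
indicator-≤ false b     _ = z≤n

count-≤ : ∀ {n} {S S′ : Fin n → Bool} → (∀ v → S′ v ≡ true → S v ≡ true) → count S′ ≤ count S
count-≤ {zero}  sub = z≤n
count-≤ {suc n} {S} {S′} sub = +-mono-≤ (indicator-≤ (S′ zero) (S zero) (sub zero)) (count-≤ (sub ∘ suc))

count-< : ∀ {n} {S S′ : Fin n → Bool} → (∀ v → S′ v ≡ true → S v ≡ true) →
  ∀ u → S u ≡ true → S′ u ≡ false → count S′ < count S
count-< {suc n} {S} {S′} sub zero u∈ u∉ rewrite u∈ | u∉ = s≤s (count-≤ (sub ∘ suc))
count-< {suc n} {S} {S′} sub (suc u) u∈ u∉ =
  subst (_≤ count S) (+-suc (if S′ zero then 1 else 0) _)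
    (+-mono-≤ (indicator-≤ (S′ zero) (S zero) (sub zero)) (count-< (sub ∘ suc) u u∈ u∉))

findᵇ : ∀ {n} (P : Fin n → Bool) → (Σ (Fin n) λ v → P v ≡ true) ⊎ (∀ v → P v ≡ false)
findᵇ P with any? (λ v → P v ≟ᵇ true)
... | yes p = inj₁ p
... | no ¬p = inj₂ λ v → [ (λ t → ⊥-elim (¬p (v , t))) , (λ f → f) ]′ (bool-dec (P v))

-- The certificates

-- Forbidden are K₄ and 2K₂; the pentagon counts as solved, and the last shape is the triangle. In
-- each certificate lemma indices count backwards from the most recently solved shape.
triangleSteps : List Step
triangleSteps =
  ((14 ∷ 3 ∷ 1 ∷ 0 ∷ 0 ∷ []) , dominated 1 0 ((0 , 0x51320) ∷ (0 , 0x51420) ∷ [])) ∷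
  ((3 ∷ 1 ∷ 0 ∷ 0 ∷ []) , dominated 3 0 ((0 , 0x43210) ∷ [])) ∷
  ((8 ∷ 2 ∷ 7 ∷ 1 ∷ 0 ∷ 0 ∷ []) , coloured 0x331301022 ((0 , 0x1420) ∷ (0 , 0x2510) ∷ (0 , 0x1630) ∷ (2 ,
      0x63420) ∷ (0 , 0x2630) ∷ (2 , 0x63510) ∷ (0 , 0x6540) ∷ (0 , 0x6510) ∷ (0 , 0x2530) ∷ (0 , 0x6420) ∷
      (0 , 0x1430) ∷ (2 , 0x24510) ∷ (0 , 0x0543) ∷ []) []) ∷
  ((15 ∷ 4 ∷ 7 ∷ 0 ∷ 1 ∷ 0 ∷ []) , dominated 3 4 ((3 , 0x65140) ∷ (3 , 0x43520) ∷ [])) ∷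
  ((32 ∷ 27 ∷ 2 ∷ 4 ∷ 3 ∷ 1 ∷ 0 ∷ []) , dominated 4 1 ((4 , 0x56240) ∷ (4 , 0x32710) ∷ (2 , 0x1650) ∷ [])) ∷
  ((4 ∷ 1 ∷ 3 ∷ 1 ∷ 0 ∷ []) , coloured 0x332221100 ((3 , 0x2540) ∷ (3 , 0x1530) ∷ (5 , 0x23410) ∷ (2 ,
      0x254310) ∷ (1 , 0x542310) ∷ (3 , 0x1320) ∷ (3 , 0x2410) ∷ (3 , 0x0543) ∷ []) ((0 , 0x5106342) ∷ (3 ,
      0x3510) ∷ [])) ∷
  ((2 ∷ 3 ∷ 1 ∷ 0 ∷ []) , coloured 0x31332022 ((4 , 0x1420) ∷ (0 , 0x24310) ∷ (0 , 0x42310) ∷ (4 , 0x0432) ∷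
      []) ((4 , 0x3210) ∷ (0 , 0x10532) ∷ (4 , 0x5210) ∷ (0 , 0x10352) ∷ [])) ∷
  ((3 ∷ 1 ∷ 0 ∷ []) , coloured 0x012 ((0 , 0x2310) ∷ (0 , 0x3210) ∷ (0 , 0x3120) ∷ (5 , 0x0321) ∷ []) []) ∷
  []

-- Forbidden are K₃ and 3K₂. The last shape, a pentagon, an edge and an isolated vertex, is the one
-- used later.
pentagonEdgeSteps : List Step
pentagonEdgeSteps =
  ((133 ∷ 1 ∷ 5 ∷ 33 ∷ 2 ∷ 4 ∷ 1 ∷ 2 ∷ 0 ∷ 0 ∷ []) , coloured 0x00331111200003333332211122222200011111110111
      [] []) ∷
  ((68 ∷ 72 ∷ 68 ∷ 17 ∷ 2 ∷ 2 ∷ 1 ∷ 1 ∷ 1 ∷ 0 ∷ []) , coloured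
      0x11133301112220012131313130010233300002200023 ((0 , 0x7a54318620) ∷ (0 , 0xa736529410) ∷ (0 ,
      0x7350a18926) ∷ (0 , 0xa530729814) ∷ []) []) ∷
  ((65 ∷ 8 ∷ 66 ∷ 36 ∷ 3 ∷ 12 ∷ 1 ∷ 1 ∷ 0 ∷ 0 ∷ []) , coloured 0x313112113113120222000223111100310000101 ((0
      , 0x207583a194) ∷ (0 , 0x26a4075193) ∷ (0 , 0x20748a3195) ∷ (1 , 0x523a147890) ∷ (0 , 0x265704a193) ∷
      (1 , 0x9701426a35) ∷ (1 , 0x9081426a35) ∷ []) ((0 , 0x310694b2a5) ∷ [])) ∷
  ((256 ∷ 68 ∷ 65 ∷ 8 ∷ 17 ∷ 3 ∷ 6 ∷ 1 ∷ 0 ∷ 0 ∷ []) , coloured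
      0x2222001211311111111111111202220022003003003000 ((0 , 0x5109a72634) ∷ (0 , 0xa684503129) ∷ (1 ,
      0x97a3540261) ∷ (2 , 0x324091a765) ∷ []) []) ∷
  ((1 ∷ 25 ∷ 16 ∷ 6 ∷ 12 ∷ 4 ∷ 4 ∷ 0 ∷ 1 ∷ 0 ∷ []) , coloured 0x3322222222212222001201110001102230223223003
      ((0 , 0x29064783a1) ∷ (1 , 0x710926a438) ∷ (2 , 0xa723680941) ∷ (0 , 0x29560783a1) ∷ (1 ,
      0x705926a438) ∷ []) ((0 , 0x3a170894b2) ∷ (3 , 0xb48597a601) ∷ (1 , 0x806a17b549) ∷ [])) ∷
  ((48 ∷ 129 ∷ 9 ∷ 16 ∷ 5 ∷ 8 ∷ 1 ∷ 0 ∷ 1 ∷ 0 ∷ []) , coloured 0x021110220022000011211 ((1 , 0xa870163259) ∷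
      (3 , 0x9a08356421) ∷ (2 , 0x6237a01594) ∷ (2 , 0x316a702485) ∷ (2 , 0xa173042958) ∷ (3 , 0x4305a87921)
      ∷ (2 , 0x6237081594) ∷ (2 , 0x316a092485) ∷ (3 , 0x9078356421) ∷ (1 , 0x79a0236148) ∷ (2 ,
      0xa173602958) ∷ (1 , 0x356017a284) ∷ (2 , 0x5237018694) ∷ (1 , 0x64302a7195) ∷ (2 , 0x72a6301849) ∷ (2
      , 0x416a029385) ∷ (3 , 0x4065a87921) ∷ (2 , 0x72a6051849) ∷ []) ((2 , 0xb084153a69) ∷ (3 ,
      0x21059ab863) ∷ (3 , 0x5016b98a32) ∷ (2 , 0x81b706295a) ∷ (3 , 0xa109467532) ∷ (3 , 0x3016a98b52) ∷
      [])) ∷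
  ((128 ∷ 12 ∷ 1 ∷ 16 ∷ 4 ∷ 1 ∷ 3 ∷ 0 ∷ 0 ∷ []) , dominated 0 3 ((3 , 0x2197086534) ∷ (4 , 0x6703549281) ∷
      (4 , 0x8703249561) ∷ (5 , 0x8352467910) ∷ (3 , 0x5197068234) ∷ (0 , 0x7630942581) ∷ (0 , 0x7830945261)
      ∷ [])) ∷
  ((168 ∷ 8 ∷ 66 ∷ 4 ∷ 5 ∷ 5 ∷ 0 ∷ 1 ∷ 1 ∷ 0 ∷ []) , coloured 0x111333300033333300133100000222220002222200
      ((3 , 0x05189a7432) ∷ (3 , 0x6a09854732) ∷ (0 , 0x6358a7402) ∷ (0 , 0x09a387452) ∷ (0 , 0x09a384752) ∷
      (2 , 0x3a45908762) ∷ (0 , 0x089a57432) ∷ (0 , 0x7915a0234) ∷ (3 , 0x09185374a2) ∷ (3 , 0x63058947a2) ∷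
      (0 , 0x6a9837402) ∷ (0 , 0x0358a7492) ∷ (0 , 0x0a3597482) ∷ (0 , 0x0a3594782) ∷ (2 , 0xa349508762) ∷
      (0 , 0x97624a308) ∷ []) []) ∷
  ((72 ∷ 8 ∷ 34 ∷ 32 ∷ 18 ∷ 9 ∷ 1 ∷ 1 ∷ 1 ∷ 0 ∷ []) , coloured 0x00030231111110303003033322223222222111 ((1
      , 0x56a421803) ∷ (0 , 0x8936a52140) ∷ (1 , 0x039856214) ∷ (4 , 0x0571896234) ∷ (0 , 0x9816052347) ∷ (1
      , 0x018956234) ∷ (4 , 0xa809352614) ∷ (1 , 0xa15386204) ∷ (3 , 0x18259036a4) ∷ (1 , 0x081592634) ∷ (4
      , 0xa105392684) ∷ (1 , 0xa89316204) ∷ (3 , 0x81295036a4) ∷ (1 , 0x035196284) ∷ (1 , 0x093586214) ∷ (1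
      , 0x687590432) ∷ (4 , 0x0871536294) ∷ []) ((1 , 0x1a4693720) ∷ (1 , 0x97803a412) ∷ (0 , 0x9a4716320b)
      ∷ (0 , 0xa927163408) ∷ [])) ∷
  ((256 ∷ 72 ∷ 1 ∷ 40 ∷ 26 ∷ 9 ∷ 1 ∷ 1 ∷ 0 ∷ 0 ∷ []) , coloured 0x00020203222222001031311311111 ((2 ,
      0xa26790381) ∷ (1 , 0x6754093218) ∷ (5 , 0xa905763421) ∷ (2 , 0xa26794301) ∷ (0 , 0x0678491235) ∷ (0 ,
      0xa590461732) ∷ (2 , 0x059274361) ∷ (2 , 0x54a139207) ∷ (2 , 0x075963421) ∷ (2 , 0x062973451) ∷ (4 ,
      0x92356074a1) ∷ (0 , 0x0298471635) ∷ (2 , 0x057694321) ∷ (2 , 0xa95724301) ∷ (1 , 0x9574a63210) ∷ (2 ,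
      0x8a4319207) ∷ (2 , 0x026794351) ∷ (2 , 0x478960123) ∷ (2 , 0x062974351) ∷ []) ((1 , 0xa98b502341) ∷
      (0 , 0x03a9581746) ∷ (1 , 0x78651a4309) ∷ (0 , 0x037b561a48) ∷ (1 , 0xa68517430b) ∷ [])) ∷
  ((0 ∷ 13 ∷ 1 ∷ 4 ∷ 6 ∷ 1 ∷ 0 ∷ 1 ∷ 0 ∷ []) , dominated 0 8 ((1 , 0x0325871496) ∷ (2 , 0x4768029315) ∷ (3 ,
      0x047638921) ∷ (0 , 0x0257468931) ∷ (0 , 0x0752368941) ∷ (3 , 0x875240139) ∷ (1 , 0x0475821396) ∷ (3 ,
      0x074368921) ∷ (3 , 0x043278961) ∷ (3 , 0x062378941) ∷ [])) ∷
  ((0 ∷ 16 ∷ 18 ∷ 3 ∷ 0 ∷ 2 ∷ 2 ∷ 1 ∷ 0 ∷ []) , coloured 0x112100222000320020111211133 ((0 , 0x726408351) ∷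
      (0 , 0x278693501) ∷ (0 , 0x726804531) ∷ (4 , 0x046852731) ∷ (4 , 0x035482761) ∷ (0 , 0x724506831) ∷ (0
      , 0x278396401) ∷ (4 , 0x064582731) ∷ (4 , 0x083562741) ∷ (4 , 0x938650147) ∷ (4 , 0x938657240) ∷ (0 ,
      0x278306451) ∷ (0 , 0x278603541) ∷ (4 , 0x038657241) ∷ (0 , 0x728306451) ∷ (0 , 0x728603541) ∷ (0 ,
      0x276408351) ∷ (0 , 0x276804531) ∷ (4 , 0x035487261) ∷ (0 , 0x274506831) ∷ (4 , 0x064587231) ∷ (6 ,
      0x3875694201) ∷ (0 , 0x796084531) ∷ (6 , 0x6874395201) ∷ []) ((0 , 0x836405712) ∷ (0 , 0x835706412) ∷
      (4 , 0x157963840) ∷ (4 , 0x146593870) ∷ (4 , 0x175693840) ∷ (4 , 0x194673850) ∷ (4 , 0xa49761058) ∷ (0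
      , 0x389714602) ∷ (0 , 0x387905612) ∷ (0 , 0x809417562) ∷ (0 , 0x384906512) ∷ (0 , 0x817509462) ∷ []))
      ∷
  ((0 ∷ 24 ∷ 1 ∷ 0 ∷ 5 ∷ 0 ∷ 1 ∷ 0 ∷ []) , coloured 0x01122032232112033113 ((1 , 0x348507261) ∷ (1 ,
      0x438507261) ∷ (1 , 0x348705621) ∷ (5 , 0x058764321) ∷ (0 , 0x084762531) ∷ (1 , 0x438705621) ∷ (5 ,
      0x058763421) ∷ (0 , 0x083762541) ∷ (1 , 0x347208561) ∷ (1 , 0x437208561) ∷ (1 , 0x347802651) ∷ (1 ,
      0x437802651) ∷ (5 , 0x027864351) ∷ (0 , 0x074865231) ∷ (5 , 0x027863451) ∷ (0 , 0x073865241) ∷ (5 ,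
      0x056284371) ∷ (0 , 0x064578231) ∷ (5 , 0x056283471) ∷ (0 , 0x063578241) ∷ (1 , 0x345608721) ∷ (5 ,
      0x085674321) ∷ (0 , 0x054827631) ∷ (1 , 0x435608721) ∷ (5 , 0x085673421) ∷ (0 , 0x053827641) ∷ (5 ,
      0x072684351) ∷ (0 , 0x024758631) ∷ (5 , 0x072683451) ∷ (0 , 0x023758641) ∷ []) ((5 , 0x091784532) ∷ (1
      , 0x409618372) ∷ (5 , 0x081794562) ∷ (1 , 0x408319672) ∷ (5 , 0x061875432) ∷ (1 , 0x508913762) ∷ []))
      ∷
  []

-- Forbidden are K₄ and 2K₂. The shapes wanted are the three collected in `pentagonLemmas`.
pentagonSteps : List Step
pentagonSteps =
  ((13 ∷ 5 ∷ 10 ∷ 5 ∷ 2 ∷ 0 ∷ 0 ∷ []) , dominated 5 1 []) ∷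
  ((78 ∷ 8 ∷ 14 ∷ 14 ∷ 5 ∷ 2 ∷ 0 ∷ 0 ∷ []) , dominated 0 5 []) ∷
  ((0 ∷ 22 ∷ 13 ∷ 6 ∷ 1 ∷ 0 ∷ 0 ∷ []) , dominated 0 4 ((0 , 0x35076214) ∷ [])) ∷
  ((101 ∷ 19 ∷ 19 ∷ 10 ∷ 2 ∷ 3 ∷ 1 ∷ 0 ∷ []) , dominated 5 0 ((0 , 0x1604825) ∷ [])) ∷
  ((14 ∷ 28 ∷ 28 ∷ 7 ∷ 5 ∷ 1 ∷ 0 ∷ 0 ∷ []) , dominated 1 3 ((1 , 0x2417608) ∷ [])) ∷
  ((110 ∷ 47 ∷ 0 ∷ 6 ∷ 4 ∷ 3 ∷ 1 ∷ 0 ∷ []) , dominated 2 4 ((0 , 0x57420163) ∷ (0 , 0x56410273) ∷ [])) ∷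
  ((0 ∷ 116 ∷ 26 ∷ 8 ∷ 1 ∷ 6 ∷ 2 ∷ 1 ∷ 0 ∷ []) , dominated 6 7 ((5 , 0x2197860) ∷ (3 , 0x7842901) ∷ [])) ∷
  ((10 ∷ 57 ∷ 25 ∷ 15 ∷ 7 ∷ 0 ∷ 2 ∷ 0 ∷ 0 ∷ []) , dominated 5 6 ((3 , 0x37298054) ∷ [])) ∷
  ((66 ∷ 7 ∷ 10 ∷ 12 ∷ 6 ∷ 0 ∷ 1 ∷ 0 ∷ []) , dominated 5 0 ((0 , 0x650487321) ∷ (0 , 0x670235841) ∷ [])) ∷
  ((14 ∷ 0 ∷ 60 ∷ 14 ∷ 13 ∷ 4 ∷ 3 ∷ 0 ∷ 0 ∷ []) , coloured 0x3311111022222000 ((8 , 0x3297650) ∷ (0 ,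
      0x96205417) ∷ (0 , 0x37289401) ∷ (6 , 0x1970542) ∷ (0 , 0x50289471) ∷ (0 , 0x93207145) ∷ (6 ,
      0x0643912) ∷ (0 , 0x93276840) ∷ (8 , 0x3279840) ∷ (0 , 0x87234905) ∷ (6 , 0x8907342) ∷ (0 ,
      0x78204519) ∷ (0 , 0x39267501) ∷ (8 , 0x7238960) ∷ (6 , 0x9803762) ∷ (6 , 0x1790452) ∷ (0 ,
      0x56209471) ∷ (0 , 0x73209154) ∷ (6 , 0x0853712) ∷ (0 , 0x73298650) ∷ (0 , 0x69235704) ∷ (6 ,
      0x6709352) ∷ (2 , 0x935740162) ∷ []) ((0 , 0xa7316028) ∷ (0 , 0xa0316528) ∷ (0 , 0x8031562a) ∷ [])) ∷
  ((7 ∷ 48 ∷ 26 ∷ 9 ∷ 6 ∷ 0 ∷ 0 ∷ 0 ∷ []) , dominated 6 7 ((9 , 0x3657840) ∷ (0 , 0x507842361) ∷ (1 ,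
      0x85634702) ∷ (7 , 0x8705346) ∷ [])) ∷
  ((112 ∷ 3 ∷ 28 ∷ 31 ∷ 5 ∷ 4 ∷ 3 ∷ 0 ∷ 0 ∷ []) , dominated 0 2 []) ∷
  ((148 ∷ 17 ∷ 55 ∷ 13 ∷ 10 ∷ 7 ∷ 2 ∷ 0 ∷ 0 ∷ []) , dominated 1 4 ((0 , 0x896453021) ∷ [])) ∷
  ((14 ∷ 11 ∷ 17 ∷ 7 ∷ 5 ∷ 2 ∷ 0 ∷ 0 ∷ []) , dominated 6 0 ((0 , 0x610523478) ∷ (1 , 0x256314078) ∷ [])) ∷
  ((14 ∷ 4 ∷ 22 ∷ 13 ∷ 3 ∷ 1 ∷ 0 ∷ 0 ∷ []) , dominated 7 0 ((0 , 0x82035471) ∷ (0 , 0x82045361) ∷ [])) ∷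
  ((144 ∷ 98 ∷ 35 ∷ 2 ∷ 13 ∷ 6 ∷ 2 ∷ 0 ∷ 0 ∷ []) , dominated 0 4 ((1 , 0x87569031) ∷ (0 , 0x75869041) ∷ [])) ∷
  ((0 ∷ 38 ∷ 11 ∷ 6 ∷ 0 ∷ 0 ∷ 1 ∷ 0 ∷ []) , dominated 5 1 ((0 , 0x031472856) ∷ (5 , 0x03178452) ∷ (13 ,
      0x7523041) ∷ (0 , 0x071432586) ∷ (5 , 0x07135482) ∷ [])) ∷
  ((128 ∷ 19 ∷ 46 ∷ 26 ∷ 4 ∷ 0 ∷ 3 ∷ 1 ∷ 0 ∷ []) , coloured 0x0000032222311111 ((6 , 0x07136284) ∷ (12 ,
      0x68937402) ∷ (6 , 0x74123085) ∷ (2 , 0x68794310) ∷ (3 , 0x21730486) ∷ (13 , 0x03568497) ∷ (14 ,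
      0x7460831) ∷ (0 , 0x72614095) ∷ (0 , 0x19257806) ∷ (14 , 0x7469830) ∷ []) ((13 , 0x140795a8) ∷ (11 ,
      0x1890a754) ∷ [])) ∷
  ((129 ∷ 22 ∷ 41 ∷ 26 ∷ 12 ∷ 0 ∷ 1 ∷ 1 ∷ 0 ∷ []) , dominated 6 3 ((4 , 0x56890271) ∷ (13 , 0x17098235) ∷ (1
      , 0x37568041) ∷ (4 , 0x86950732) ∷ [])) ∷
  ((0 ∷ 6 ∷ 14 ∷ 6 ∷ 6 ∷ 2 ∷ 0 ∷ 0 ∷ []) , dominated 0 1 ((5 , 0x31570684) ∷ (14 , 0x26053487) ∷ (0 ,
      0x536170842) ∷ (1 , 0x047826531) ∷ (1 , 0x063284571) ∷ [])) ∷
  ((148 ∷ 92 ∷ 2 ∷ 21 ∷ 13 ∷ 3 ∷ 0 ∷ 1 ∷ 0 ∷ []) , dominated 7 1 ((6 , 0x23670984) ∷ (0 , 0x46978203) ∷ [])) ∷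
  ((34 ∷ 0 ∷ 21 ∷ 6 ∷ 7 ∷ 0 ∷ 1 ∷ 0 ∷ []) , dominated 0 3 ((0 , 0x315706284) ∷ (18 , 0x3750162) ∷ (10 ,
      0x05271863) ∷ (18 , 0x3570612) ∷ (1 , 0x53761402) ∷ (7 , 0x42630751) ∷ (20 , 0x5207631) ∷ [])) ∷
  ((42 ∷ 8 ∷ 7 ∷ 4 ∷ 5 ∷ 3 ∷ 1 ∷ 0 ∷ []) , dominated 3 0 ((8 , 0x12530784) ∷ (0 , 0x07341528) ∷ (2 ,
      0x83754102) ∷ [])) ∷
  ((34 ∷ 3 ∷ 2 ∷ 5 ∷ 2 ∷ 0 ∷ 0 ∷ []) , dominated 0 4 ((9 , 0x56470321) ∷ (0 , 0x13072465) ∷ (22 , 0x4607231)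
      ∷ (20 , 0x1420736) ∷ (20 , 0x7230416) ∷ (1 , 0x54170362) ∷ (3 , 0x27341506) ∷ [])) ∷
  ((2 ∷ 18 ∷ 27 ∷ 3 ∷ 2 ∷ 2 ∷ 1 ∷ 0 ∷ []) , coloured 0x303222213001111 ((9 , 0x28607415) ∷ (20 , 0x04267835)
      ∷ (0 , 0x7108462) ∷ (0 , 0x6108274) ∷ (0 , 0x3657021) ∷ (0 , 0x4150782) ∷ (9 , 0x67538410) ∷ (0 ,
      0x4106785) ∷ (0 , 0x2107684) ∷ (21 , 0x5863740) ∷ []) ((0 , 0x2310974) ∷ [])) ∷
  ((99 ∷ 28 ∷ 2 ∷ 13 ∷ 4 ∷ 2 ∷ 0 ∷ 0 ∷ []) , coloured 0x002023221121322322 ((1 , 0x6308742) ∷ (1 ,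
      0x3605741) ∷ (1 , 0x7302864) ∷ (1 , 0x1607543) ∷ (1 , 0x7604351) ∷ (0 , 0x72408163) ∷ (1 , 0x3601475)
      ∷ (1 , 0x8304276) ∷ (1 , 0x7304682) ∷ (1 , 0x2306487) ∷ (1 , 0x5604173) ∷ (1 , 0x1027543) ∷ []) ((1 ,
      0x7501243) ∷ (1 , 0x8401793) ∷ (1 , 0x4710852) ∷ (1 , 0x0415793) ∷ [])) ∷
  ((70 ∷ 53 ∷ 8 ∷ 13 ∷ 0 ∷ 3 ∷ 1 ∷ 0 ∷ []) , coloured 0x1322231133000 ((2 , 0x3601542) ∷ (0 , 0x35172640) ∷
      (2 , 0x3602451) ∷ (1 , 0x14302856) ∷ (2 , 0x3072451) ∷ (0 , 0x15384620) ∷ (2 , 0x1604253) ∷ (1 ,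
      0x32104756) ∷ (2 , 0x1084253) ∷ (2 , 0x6578310) ∷ (2 , 0x6587130) ∷ []) ((1 , 0x43205167) ∷ [])) ∷
  ((27 ∷ 50 ∷ 1 ∷ 7 ∷ 3 ∷ 2 ∷ 0 ∷ 0 ∷ []) , coloured 0x0122021033333 ((3 , 0x8306752) ∷ (0 , 0x10375826) ∷
      (1 , 0x58716320) ∷ (3 , 0x8302576) ∷ (0 , 0x10386725) ∷ (3 , 0x7845310) ∷ (3 , 0x7854130) ∷ (3 ,
      0x5306287) ∷ (12 , 0x85746230) ∷ (23 , 0x42785610) ∷ (2 , 0x65872403) ∷ (3 , 0x5016287) ∷ []) ((21 ,
      0x18605973) ∷ [])) ∷
  ((37 ∷ 1 ∷ 5 ∷ 3 ∷ 0 ∷ 1 ∷ 0 ∷ []) , coloured 0x3000311122222 ((0 , 0x27360514) ∷ (25 , 0x1630725) ∷ (4 ,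
      0x7506231) ∷ (1 , 0x40523716) ∷ (2 , 0x37246510) ∷ (25 , 0x2760135) ∷ (4 , 0x2503761) ∷ (4 ,
      0x1507362) ∷ (1 , 0x04571362) ∷ (0 , 0x72630514) ∷ (2 , 0x62743510) ∷ (4 , 0x2501673) ∷ (3 ,
      0x36201475) ∷ (4 , 0x3506172) ∷ (3 , 0x63701425) ∷ (4 , 0x3046172) ∷ []) ((3 , 0x43708126) ∷ (4 ,
      0x8601342) ∷ (3 , 0x74802136) ∷ (4 , 0x0617342) ∷ [])) ∷
  ((0 ∷ 12 ∷ 5 ∷ 1 ∷ 0 ∷ 0 ∷ []) , coloured 0x013120202222 ((28 , 0x3106452) ∷ (26 , 0x4620351) ∷ (26 ,
      0x5630241) ∷ (0 , 0x3410526) ∷ (5 , 0x5104632) ∷ (26 , 0x6540231) ∷ (0 , 0x4310625) ∷ (5 , 0x6103542)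
      ∷ (26 , 0x6450321) ∷ (0 , 0x5210634) ∷ (5 , 0x6102453) ∷ (26 , 0x5360421) ∷ (0 , 0x6210543) ∷ (5 ,
      0x5102364) ∷ (0 , 0x6310452) ∷ (5 , 0x4103265) ∷ []) ((5 , 0x7210653) ∷ (5 , 0x0214653) ∷ [])) ∷
  ((73 ∷ 28 ∷ 10 ∷ 11 ∷ 1 ∷ 3 ∷ 1 ∷ 0 ∷ []) , coloured 0x03211112200232233 ((0 , 0x146203) ∷ (0 , 0x137204)
      ∷ (0 , 0x437601) ∷ (0 , 0x248103) ∷ (0 , 0x587310) ∷ []) ((26 , 0x76549810) ∷ [])) ∷
  ((12 ∷ 21 ∷ 25 ∷ 6 ∷ 7 ∷ 1 ∷ 0 ∷ 0 ∷ []) , coloured 0x2211223110003 ((0 , 0x34752108) ∷ (27 , 0x05813472)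
      ∷ (1 , 0x867301) ∷ (0 , 0x43756801) ∷ (1 , 0x543210) ∷ (27 , 0x05184376) ∷ (25 , 0x74620853) ∷ (1 ,
      0x127408) ∷ (0 , 0x34752160) ∷ (25 , 0x73260154) ∷ (0 , 0x43756820) ∷ []) ((26 , 0x95861470) ∷ (26 ,
      0x24861530) ∷ [])) ∷
  ((39 ∷ 45 ∷ 5 ∷ 14 ∷ 3 ∷ 1 ∷ 0 ∷ 0 ∷ []) , coloured 0x31112223010220 ((1 , 0x70625831) ∷ (1 , 0x47123508)
      ∷ (28 , 0x62587410) ∷ (1 , 0x74625830) ∷ (26 , 0x63451072) ∷ (2 , 0x357420) ∷ (2 , 0x357108) ∷ (2 ,
      0x156308) ∷ []) []) ∷
  ((7 ∷ 22 ∷ 7 ∷ 6 ∷ 0 ∷ 1 ∷ 0 ∷ []) , coloured 0x333000322211111 ((27 , 0x47610532) ∷ (0 , 0x57462130) ∷ (2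
      , 0x72436510) ∷ (1 , 0x54637210) ∷ (0 , 0x56473120) ∷ (2 , 0x63427510) ∷ (1 , 0x54726310) ∷ (3 ,
      0x327610) ∷ []) ((0 , 0x68573041) ∷ (0 , 0x67584031) ∷ [])) ∷
  ((34 ∷ 7 ∷ 6 ∷ 4 ∷ 3 ∷ 1 ∷ 0 ∷ []) , coloured 0x11330002221113323 ((0 , 0x2410736) ∷ (4 , 0x465201) ∷ (30
      , 0x07143256) ∷ (0 , 0x3645720) ∷ (4 , 0x374210) ∷ []) ((0 , 0x0261835) ∷ (30 , 0x18054367) ∷ (0 ,
      0x4751830) ∷ (0 , 0x4657801) ∷ [])) ∷
  ((28 ∷ 11 ∷ 6 ∷ 0 ∷ 1 ∷ 0 ∷ []) , coloured 0x23223333111000 ((1 , 0x5346210) ∷ (5 , 0x453210) ∷ (0 ,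
      0x2364510) ∷ (0 , 0x1564320) ∷ []) ((1 , 0x6754310) ∷ (1 , 0x6451320) ∷ [])) ∷
  ((31 ∷ 12 ∷ 3 ∷ 2 ∷ 0 ∷ 0 ∷ []) , coloured 0x12202110303 ((0 , 0x032465) ∷ (0 , 0x063254) ∷ (0 , 0x054263)
      ∷ (0 , 0x130465) ∷ (0 , 0x065432) ∷ (0 , 0x150263) ∷ (0 , 0x056342) ∷ (0 , 0x160254) ∷ (0 , 0x150342)
      ∷ (0 , 0x160432) ∷ (6 , 0x564320) ∷ []) ((0 , 0x174065) ∷ (0 , 0x103576) ∷ (0 , 0x176043) ∷ (0 ,
      0x105374) ∷ (0 , 0x104365) ∷ (0 , 0x106543) ∷ [])) ∷
  []

-- The positions 0, 1, 2, 3, 4 follow the cycle in this order.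
pentagon : Σ ℕ Shape
pentagon = _ , shapeOf (9 ∷ 1 ∷ 1 ∷ 1 ∷ 0 ∷ [])

pentagonSteps-checked : Search.Checked 3 1 [] pentagonSteps
pentagonSteps-checked = Search.checked refl

triangleSteps-checked : Search.Checked 3 1 (pentagon ∷ []) triangleSteps
triangleSteps-checked = Search.checked refl

pentagonEdgeSteps-checked : Search.Checked 2 2 [] pentagonEdgeSteps
pentagonEdgeSteps-checked = Search.checked refl

-- The pentagon and a vertex with no, four and five neighbours on it.
pentagonLemmas : Lemmas
pentagonLemmas =
  (_ , shapeOf (0 ∷ 12 ∷ 5 ∷ 1 ∷ 0 ∷ 0 ∷ [])) ∷
  (_ , shapeOf (28 ∷ 11 ∷ 6 ∷ 0 ∷ 1 ∷ 0 ∷ [])) ∷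
  (_ , shapeOf (31 ∷ 12 ∷ 3 ∷ 2 ∷ 0 ∷ 0 ∷ [])) ∷ []

-- One list serves the pentagon with one, two or three further vertices. These come before the
-- pentagon, so its positions shift by their number.
pentagonOccurrences : List Occurrence
pentagonOccurrences =
  (2 , 0x524310) ∷ (1 , 0x031452) ∷ (1 , 0x052431) ∷ (1 , 0x013542) ∷ (1 , 0x024153) ∷ (1 , 0x025341) ∷
  (0 , 0x254310) ∷ (1 , 0x012563) ∷ (1 , 0x035164) ∷ (1 , 0x104653) ∷ (1 , 0x063142) ∷ (1 , 0x016452) ∷
  (1 , 0x142063) ∷ (1 , 0x136052) ∷ (1 , 0x105264) ∷ (1 , 0x124053) ∷ (1 , 0x103542) ∷ (1 , 0x102563) ∷
  (1 , 0x135064) ∷ (1 , 0x014653) ∷ (1 , 0x163042) ∷ (1 , 0x106452) ∷ (1 , 0x042163) ∷ (1 , 0x036152) ∷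
  (1 , 0x015264) ∷ (1 , 0x102764) ∷ (1 , 0x132064) ∷ (1 , 0x172053) ∷ []

pentagonEdge : Shape 7
pentagonEdge = shapeOf (1 ∷ 0 ∷ 9 ∷ 1 ∷ 1 ∷ 1 ∷ 0 ∷ [])

-- The disjoint union of a pentagon, an edge and a vertex.
pentagonEdgeLemmas : Lemmas
pentagonEdgeLemmas = (_ , shapeOf (0 ∷ 24 ∷ 1 ∷ 0 ∷ 5 ∷ 0 ∷ 1 ∷ 0 ∷ [])) ∷ []

pentagonEdgeOccurrences : List Occurrence
pentagonEdgeOccurrences = (0 , 0x67452130) ∷ []

-- The bounding functions

g₂ : ℕ → ℕ
g₂ 0 = 3
g₂ 1 = 4
g₂ (suc (suc p)) = 2 + g₂ (suc p)

g₃ : ℕ → ℕ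
g₃ 0 = 4
g₃ 1 = 12
g₃ (suc (suc p)) = g₃ (suc p) + (2 * g₂ (suc p) + 3)

-- f is not monotone in its second argument: f 3 3 = 13 and f 3 4 = 12.
-- The induction runs on the smaller, monotone g, whose first argument is shifted by two.
g : ℕ → ℕ → ℕ
g p 0 = 0
g p 1 = 1
g p 2 = g₂ p
g p 3 = g₃ p
g 0       (suc (suc (suc (suc s)))) = 4 + s
g (suc p) (suc (suc (suc (suc s)))) = g p (4 + s) + 2 * g p (3 + s)

-- The margin of 2 absorbs the summand 3 of `g₃` when `g-mono` compares `2 * g₂ + 3` with `2 * g₃`.
-- At first argument 0 the values 3 and 4 would violate it.
g-2+2≤g-3 : ∀ p → 2 + g (suc p) 2 ≤ g (suc p) 3
g-2+2≤g-3 zero    = s≤s (s≤s (s≤s (s≤s (s≤s (s≤s z≤n)))))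
g-2+2≤g-3 (suc p) = ≤-trans (+-monoʳ-≤ 2 (g-2+2≤g-3 p))
  (≤-trans (≤-reflexive (+-comm 2 _)) (+-monoʳ-≤ (g (suc p) 3) (m≤n⇒m≤o+n (2 * g (suc p) 2) (s≤s (s≤s z≤n)))))

g-mono : ∀ p m → g p m ≤ g p (suc m)
g-mono p 0 = z≤n
g-mono 0 1 = s≤s z≤n
g-mono 1 1 = s≤s z≤n
g-mono (suc (suc p)) 1 = s≤s z≤n
g-mono 0 2 = n≤1+n 3
g-mono (suc p) 2 = ≤-trans (m≤n+m _ 2) (g-2+2≤g-3 p)
g-mono 0 3 = ≤-refl
-- Tight: both sides are 12.
g-mono 1 3 = ≤-refl
g-mono (suc (suc p)) 3 = +-mono-≤ (g-mono (suc p) 3)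
  (≤-trans (+-monoʳ-≤ (2 * g (suc p) 2) (n≤1+n 3))
    (≤-trans (≤-reflexive (double (g (suc p) 2))) (*-monoʳ-≤ 2 (g-2+2≤g-3 p))))
  where
    double : ∀ x → 2 * x + 4 ≡ 2 * (2 + x)
    double = solve-∀
g-mono 0 (suc (suc (suc (suc s)))) = n≤1+n _
g-mono (suc p) (suc (suc (suc (suc s)))) = +-mono-≤ (g-mono p (4 + s)) (*-monoʳ-≤ 2 (g-mono p (3 + s)))

-- Lets the vertices that miss exactly one clique vertex, which use at most 3 + s colours, fit into
-- the palette of the vertices with a single neighbour in the clique.
m≤g : ∀ p s → 3 + s ≤ g p (3 + s)
m≤g 0 zero = n≤1+n 3
m≤g 1 zero = s≤s (s≤s (s≤s z≤n))
m≤g (suc (suc p)) zero = m≤n⇒m≤n+o _ (m≤g (suc p) zero)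
m≤g 0 (suc s) = ≤-refl
m≤g (suc p) (suc s) = m≤n⇒m≤n+o _ (m≤g p (suc s))

g-2 : ∀ p → g (suc p) 2 ≡ 4 + 2 * p
g-2 zero    = refl
g-2 (suc p) = trans (cong (2 +_) (g-2 p)) (step p)
  where
    step : ∀ p → 2 + (4 + 2 * p) ≡ 4 + 2 * (1 + p)
    step = solve-∀

g-3 : ∀ p → g (suc p) 3 ≡ 12 + (9 * p + 2 * p * p)
g-3 zero    = refl
g-3 (suc p) = trans (cong₂ (λ x y → x + (2 * y + 3)) (g-3 p) (g-2 p)) (step p)
  where
    step : ∀ p → 12 + (9 * p + 2 * p * p) + (2 * (4 + 2 * p) + 3) ≡ 12 + (9 * (1 + p) + 2 * (1 + p) * (1 + p))
    step = solve-∀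

g≤f : ∀ p m → g p m ≤ f (2 + p) m
g≤f p 0 = z≤n
g≤f p 1 = ≤-refl
g≤f 0 2 = ≤-refl
g≤f (suc p) 2 = ≤-reflexive (trans (g-2 p)
  (sym (trans (cong (_∸ 2) (expand p)) (m+n∸m≡n 2 (4 + 2 * p)))))
  where
    expand : ∀ p → 2 * (3 + p) ≡ 2 + (4 + 2 * p)
    expand = solve-∀
g≤f 0 3 = ≤-refl
-- In terms of P = p + 3 the left side is 2P² - 3P + 3, one less than `f`; hence `n≤1+n`.
g≤f (suc p) 3 = ≤-trans (≤-reflexive (g-3 p)) (≤-trans (n≤1+n _) (≤-reflexive (trans (regroup p)
  (cong (_+ 4) (sym (trans (cong (_∸ 3 * (3 + p)) (expand p)) (m+n∸m≡n (3 * (3 + p)) _)))))))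
  where
    expand : ∀ p → 2 * (3 + p) * (3 + p) ≡ 3 * (3 + p) + (9 + (9 * p + 2 * p * p))
    expand = solve-∀
    regroup : ∀ p → 13 + (9 * p + 2 * p * p) ≡ (9 + (9 * p + 2 * p * p)) + 4
    regroup = solve-∀
g≤f 0 (suc (suc (suc (suc s)))) = ≤-refl
g≤f (suc p) (suc (suc (suc (suc s)))) = +-mono-≤ (g≤f p (4 + s)) (*-monoʳ-≤ 2 (g≤f p (3 + s)))

-- Choosing among at least four indices

AtMostOne : ∀ {m} → (Fin m → Bool) → Set
AtMostOne p = ∀ i j → i ≢ j → p i ≡ true → p j ≡ true → ⊥

-- Each predicate removes at most one of the first four indices, so two survive. This is what a
-- clique on four vertices provides.
two-outside : ∀ {s} (p q : Fin (4 + s) → Bool) → AtMostOne p → AtMostOne q →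
  Σ (Fin (4 + s)) λ a → Σ (Fin (4 + s)) λ b → a ≢ b × p a ≡ false × p b ≡ false × q a ≡ false × q b ≡ false
two-outside {s} p q amp amq = go (bool-dec (p 0F)) (bool-dec (p 1F)) (bool-dec (p 2F))
  where
    0F 1F 2F 3F : Fin (4 + s)
    0F = zero
    1F = suc zero
    2F = suc (suc zero)
    3F = suc (suc (suc zero))
    Result : Set
    Result = Σ (Fin (4 + s)) λ a → Σ (Fin (4 + s)) λ b →
      a ≢ b × p a ≡ false × p b ≡ false × q a ≡ false × q b ≡ false
    other : ∀ (r : Fin (4 + s) → Bool) → AtMostOne r → ∀ {i} j → i ≢ j → r i ≡ true → r j ≡ false
    other r am j i≢j ri = ≢true⇒false (am _ j i≢j ri)
    three : ∀ i j k → i ≢ j → i ≢ k → j ≢ k → p i ≡ false → p j ≡ false → p k ≡ false → Result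
    three i j k i≢j i≢k j≢k pi pj pk with bool-dec (q i) | bool-dec (q j)
    ... | inj₁ qi | _       = j , k , j≢k , pj , pk , other q amq j i≢j qi , other q amq k i≢k qi
    ... | inj₂ qi | inj₂ qj = i , j , i≢j , pi , pj , qi , qj
    ... | inj₂ qi | inj₁ qj = i , k , i≢k , pi , pk , qi , other q amq k j≢k qj
    go : (p 0F ≡ true) ⊎ (p 0F ≡ false) → (p 1F ≡ true) ⊎ (p 1F ≡ false) → (p 2F ≡ true) ⊎ (p 2F ≡ false) → Result
    go (inj₁ t) _ _ = three 1F 2F 3F (λ ()) (λ ()) (λ ())
      (other p amp 1F (λ ()) t) (other p amp 2F (λ ()) t) (other p amp 3F (λ ()) t)
    go (inj₂ a) (inj₁ t) _ = three 0F 2F 3F (λ ()) (λ ()) (λ ()) a (other p amp 2F (λ ()) t) (other p amp 3F (λ ()) t)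
    go (inj₂ a) (inj₂ b) (inj₁ t) = three 0F 1F 3F (λ ()) (λ ()) (λ ()) a b (other p amp 3F (λ ()) t)
    go (inj₂ a) (inj₂ b) (inj₂ c) = three 0F 1F 2F (λ ()) (λ ()) (λ ()) a b c

⌊⌋-elim : ∀ {m} {i j : Fin m} → ⌊ i ≟ᶠ j ⌋ ≡ true → i ≡ j
⌊⌋-elim {i = i} {j} e with i ≟ᶠ j
... | yes p = p

⌊⌋-false : ∀ {m} {i j : Fin m} → ⌊ i ≟ᶠ j ⌋ ≡ false → i ≢ j
⌊⌋-false {i = i} {j} e with i ≟ᶠ j
... | no p = p

⌊⌋-≢ : ∀ {m} {i j : Fin m} → i ≢ j → ⌊ i ≟ᶠ j ⌋ ≡ false
⌊⌋-≢ ne = ≢true⇒false (ne ∘ ⌊⌋-elim)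

⌊⌋-suc : ∀ {m} (i j : Fin m) → ⌊ suc i ≟ᶠ suc j ⌋ ≡ ⌊ i ≟ᶠ j ⌋
⌊⌋-suc i j with i ≟ᶠ j
... | yes _ = refl
... | no _  = refl

equals-AtMostOne : ∀ {m} (j : Fin m) → AtMostOne (λ i → ⌊ i ≟ᶠ j ⌋)
equals-AtMostOne j a b a≢b ea eb = a≢b (trans (⌊⌋-elim ea) (sym (⌊⌋-elim eb)))

-- Vertex sets, cliques, induced matchings and colourings

module Graphs {n : ℕ} (G : Graph (Fin n)) (simple : IsSimple G) where

  V : Set
  V = Fin n

  adj : V → V → Bool
  adj = Adj G

  adj-sym : ∀ {u v b} → adj u v ≡ b → adj v u ≡ b
  adj-sym {u} {v} e = trans (proj₁ simple v u) e

  adj-irrefl : ∀ {u v} → adj u v ≡ true → u ≢ v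
  adj-irrefl {u} e refl = true≢false e (proj₂ simple u)

  Sub : Set
  Sub = V → Bool

  infix 4 _∈ₛ_ _⊆ₛ_

  _∈ₛ_ : V → Sub → Set
  v ∈ₛ S = S v ≡ true

  _⊆ₛ_ : Sub → Sub → Set
  S ⊆ₛ S′ = ∀ {v} → v ∈ₛ S → v ∈ₛ S′

  infixl 6 _∩_ _∖_

  _∩_ : Sub → (V → Bool) → Sub
  (S ∩ P) v = S v ∧ P v

  _∖_ : Sub → (V → Bool) → Sub
  (S ∖ P) v = S v ∧ not (P v)

  far : V → V → V → Bool
  far u v w = not (adj u w) ∧ not (adj v w)

  Clique : ℕ → Sub → Set
  Clique m S = Σ (Fin m → V) λ φ → (∀ i → φ i ∈ₛ S) × (∀ i j → i ≢ j → adj (φ i) (φ j) ≡ true)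

  -- Listing an induced pK₂ edge by edge, each far from the earlier ones, makes passage to a far set
  -- lower p by definition.
  Matching : ℕ → Sub → Set
  Matching zero    S = ⊤
  Matching (suc p) S = Σ V λ u → Σ V λ v → u ∈ₛ S × v ∈ₛ S × adj u v ≡ true × Matching p (S ∩ far u v)

  Colourable : Sub → ℕ → Set
  Colourable S k = Σ (V → ℕ) λ c → (∀ v → v ∈ₛ S → c v < k) ×
    (∀ u v → u ∈ₛ S → v ∈ₛ S → adj u v ≡ true → c u ≢ c v)

  Clique-cons : ∀ {m S S′} u → u ∈ₛ S → S′ ⊆ₛ S ∩ adj u → Clique m S′ → Clique (suc m) S
  Clique-cons {m} {S} u u∈ sub (φ , φ∈ , φ~) = ψ , ψ∈ , ψ~
    where
      ψ : Fin (suc m) → V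
      ψ zero    = u
      ψ (suc i) = φ i
      ψ∈ : ∀ i → ψ i ∈ₛ S
      ψ∈ zero    = u∈
      ψ∈ (suc i) = proj₁ (∧-elim (sub (φ∈ i)))
      ψ~ : ∀ i j → i ≢ j → adj (ψ i) (ψ j) ≡ true
      ψ~ zero    zero    i≢j = ⊥-elim (i≢j refl)
      ψ~ zero    (suc j) _   = proj₂ (∧-elim (sub (φ∈ j)))
      ψ~ (suc i) zero    _   = adj-sym (proj₂ (∧-elim {S (φ i)} (sub (φ∈ i))))
      ψ~ (suc i) (suc j) i≢j = φ~ i j (i≢j ∘ cong suc)

  Clique-mono : ∀ {m S S′} → S ⊆ₛ S′ → Clique m S → Clique m S′
  Clique-mono sub (φ , φ∈ , φ~) = φ , (λ i → sub (φ∈ i)) , φ~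

  Matching-mono : ∀ p {S S′} → S ⊆ₛ S′ → Matching p S → Matching p S′
  Matching-mono zero    sub _ = tt
  Matching-mono (suc p) sub (u , v , u∈ , v∈ , e , M) =
    u , v , sub u∈ , sub v∈ , e ,
    Matching-mono p (λ w∈ → let a , b = ∧-elim w∈ in ∧-intro (sub a) b) M

  module _ {A : Set} (E : A → A → Bool) (h : A → V) (hE : ∀ a b → E a b ≡ adj (h a) (h b)) where

    hasClique-sound : ∀ q xs S → (∀ {a} → a ∈ xs → h a ∈ₛ S) → hasClique E q xs ≡ true → Clique q S
    hasClique-sound zero    xs S h∈ _ = (λ ()) , (λ ()) , (λ ())
    hasClique-sound (suc q) (x ∷ xs) S h∈ e = [ through-x , hasClique-sound (suc q) xs S (h∈ ∘ there) ]′ (∨-elim e)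
      where
        through-x : hasClique E q (filterᵇ (E x) xs) ≡ true → Clique (suc q) S
        through-x e′ = Clique-cons {S = S} {S ∩ adj (h x)} (h x) (h∈ (here refl)) (λ z → z)
          (hasClique-sound q (filterᵇ (E x) xs) (S ∩ adj (h x))
            (λ a∈ → let b , c = filterᵇ-elim (E x) xs a∈ in
               ∧-intro (h∈ (there b)) (trans (sym (hE x _)) c)) e′)

    hasMatching-sound : ∀ p xs S → (∀ {a} → a ∈ xs → h a ∈ₛ S) → hasMatching E p xs ≡ true → Matching p S
    hasMatching-sound zero    xs S h∈ _ = tt
    hasMatching-sound (suc p) (x ∷ xs) S h∈ e =
      [ through-x , hasMatching-sound (suc p) xs S (h∈ ∘ there) ]′ (∨-elim {any through xs} e)
      where
        apart : A → A → Bool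
        apart y z = not (E x z) ∧ not (E y z)
        through : A → Bool
        through y = E x y ∧ hasMatching E p (filterᵇ (apart y) xs)
        through-x : any through xs ≡ true → Matching (suc p) S
        through-x e′ =
          let y , y∈ , ey = any-elim through xs e′
              exy , m = ∧-elim ey in
          h x , h y , h∈ (here refl) , h∈ (there y∈) , trans (sym (hE x y)) exy ,
          hasMatching-sound p (filterᵇ (apart y) xs) (S ∩ far (h x) (h y))
            (λ {a} a∈ → let b , c = filterᵇ-elim (apart y) xs a∈
                            c₁ , c₂ = ∧-elim {not (E x a)} c in
               ∧-intro (h∈ (there b))
                 (∧-intro (trans (cong not (sym (hE x a))) c₁) (trans (cong not (sym (hE y a))) c₂)))
            m

  -- Soundness of the certificates

  module Configurations (S : Sub) where

    -- The vertices need not be distinct.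
    Conf : ∀ {k} → Shape k → Vec V k → Set
    Conf ∅       []       = ⊤
    Conf (r ▹ s) (x ∷ xs) = x ∈ₛ S × Vec.map (adj x) xs ≡ r × Conf s xs

    Conf-∈ : ∀ {k} (s : Shape k) {xs} → Conf s xs → ∀ i → lookup xs i ∈ₛ S
    Conf-∈ (r ▹ s) {x ∷ xs} (x∈ , _ , c) zero    = x∈
    Conf-∈ (r ▹ s) {x ∷ xs} (x∈ , _ , c) (suc i) = Conf-∈ s c i

    edge-sound : ∀ {k} (s : Shape k) {xs} → Conf s xs → ∀ i j → edge s i j ≡ adj (lookup xs i) (lookup xs j)
    edge-sound (r ▹ s) {x ∷ xs} (_ , e , c) zero zero = sym (proj₂ simple x)
    edge-sound (r ▹ s) {x ∷ xs} (_ , refl , c) zero (suc j) = lookup-map j (adj x) xs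
    edge-sound (r ▹ s) {x ∷ xs} (_ , refl , c) (suc i) zero =
      trans (lookup-map i (adj x) xs) (adj-sym refl)
    edge-sound (r ▹ s) {x ∷ xs} (_ , e , c) (suc i) (suc j) = edge-sound s c i j

    matches-sound : ∀ {k N} (B : Shape k) (s : Shape N) {xs} (ps : Vec (Fin N) k) →
      Conf s xs → matches B s ps ≡ true → Conf B (Vec.map (lookup xs) ps)
    matches-sound ∅       s []       c _ = tt
    matches-sound (r ▹ B) s {xs} (p ∷ ps) c e =
      let e₁ , e₂ = ∧-elim e in
      Conf-∈ s c p ,
      trans (sym (map-∘ (adj (lookup xs p)) (lookup xs) ps))
        (trans (map-cong (λ j → sym (edge-sound s c p j)) ps) (sym (==-sound r _ e₁))) ,
      matches-sound B s ps c e₂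

    NoDomination : Set
    NoDomination = ∀ u v → u ∈ₛ S → v ∈ₛ S → u ≢ v → adj u v ≡ false →
      Σ V λ x → x ∈ₛ S × adj u x ≡ true × adj v x ≡ false

    module Proofs (q p : ℕ) (¬K : ¬ Clique (suc q) S) (¬M : ¬ Matching (suc p) S) where

      open Search q p

      refuted-sound : ∀ {k} (s : Shape k) {xs} → Conf s xs → ∀ {x} → x ∈ₛ S →
        refuted (Vec.map (adj x) xs) s ≡ false
      refuted-sound {k} s {xs} c {x} x∈ with refuted (Vec.map (adj x) xs) s in eq
      ... | false = refl
      ... | true with ∨-elim {hasClique (edge s) q (filterᵇ (lookup (Vec.map (adj x) xs)) (allFin k))} eq
      ...   | inj₁ e = ⊥-elim (¬K (Clique-cons {S = S} {S ∩ adj x} x x∈ (λ z → z)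
              (hasClique-sound (edge s) (lookup xs) (edge-sound s c) q _ (S ∩ adj x)
                (λ {i} i∈ → ∧-intro (Conf-∈ s c i)
                   (trans (sym (lookup-map i (adj x) xs)) (proj₂ (filterᵇ-elim _ (allFin k) i∈)))) e)))
      ...   | inj₂ e with any-elim _ (filterᵇ (lookup (Vec.map (adj x) xs)) (allFin k)) e
      ...     | a , a∈ , e′ = ⊥-elim (¬M
                (x , lookup xs a , x∈ , Conf-∈ s c a ,
                 trans (sym (lookup-map a (adj x) xs)) (proj₂ (filterᵇ-elim _ (allFin k) a∈)) ,
                 hasMatching-sound (edge s) (lookup xs) (edge-sound s c) p _ (S ∩ far x (lookup xs a))
                   (λ {i} i∈ → let f₁ , f₂ = ∧-elim {not (lookup (Vec.map (adj x) xs) i)}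
                                                (proj₂ (filterᵇ-elim _ (allFin k) i∈)) in
                      ∧-intro (Conf-∈ s c i)
                        (∧-intro (trans (cong not (sym (lookup-map i (adj x) xs))) f₁)
                                 (trans (cong not (sym (edge-sound s c a i))) f₂)))
                   e′))

      keep-complete : ∀ {k} (s : Shape k) {xs} → Conf s xs → ∀ {x} → x ∈ₛ S →
        Vec.map (adj x) xs ∈ keep s (Vec.map (adj x) xs)
      keep-complete s {xs} c {x} x∈ with refuted (Vec.map (adj x) xs) s in eq
      ... | false = here refl
      ... | true  = ⊥-elim (true≢false eq (refuted-sound s c x∈))

      -- No pruning step can drop the row of an actual vertex: refuting it on some of the older
      -- vertices would already exhibit a forbidden graph in `S`.
      rows-complete : ∀ {k} (s : Shape k) {xs} → Conf s xs → ∀ {x} → x ∈ₛ S →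
        Vec.map (adj x) xs ∈ rows s
      rows-complete ∅       {[]} c x∈ = here refl
      rows-complete (r ▹ s) {y ∷ ys} c@(_ , _ , c′) {x} x∈ =
        ∈-concatMap⁺ _ (lose (rows-complete s c′ x∈) (kept (keep-complete (r ▹ s) c x∈)))
        where
          m = Vec.map (adj x) ys
          kept : ∀ {b} → b ∷ m ∈ keep (r ▹ s) (b ∷ m) →
            b ∷ m ∈ keep (r ▹ s) (true ∷ m) ++ keep (r ▹ s) (false ∷ m)
          kept {true}  = ∈-++⁺ˡ
          kept {false} = ∈-++⁺ʳ (keep (r ▹ s) (true ∷ m))

      Solved : Set → Σ ℕ Shape → Set
      Solved Goal (k , B) = ∀ xs → Conf B xs → Goal

      occurs-sound : ∀ {Goal N} {Γ} → All (Solved Goal) Γ → (s : Shape (suc N)) → ∀ {xs} → Conf s xs →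
        ∀ i c → occurs Γ s i c ≡ true → Goal
      occurs-sound {Γ = (k , B) ∷ Γ} (sol ∷ sols) s conf zero c e =
        sol _ (matches-sound B s (positions k c) conf e)
      occurs-sound {Γ = _ ∷ Γ} (sol ∷ sols) s conf (suc i) c e = occurs-sound sols s conf i c e

      covered-sound : ∀ {Goal N} {Γ} → All (Solved Goal) Γ → ∀ os (s : Shape (suc N)) {xs} → Conf s xs →
        covered Γ os s ≡ true → Goal
      covered-sound sols os s conf e with any-elim _ os e
      ... | (i , c) , _ , e′ = occurs-sound sols s conf i c e′

      colourIn-< : ∀ {k} (ts : List (Row k)) c m → colourIn ts c m < 4
      colourIn-< []       c m = s≤s z≤n
      colourIn-< (t ∷ ts) c m with t == m
      ... | true  = m%n<n c 4
      ... | false = colourIn-< ts (c / 16) m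

      pairwise-elim : {A : Set} (P : A → A → Bool) (xs : List A) → pairwise P xs ≡ true →
        ∀ {x y} → x ∈ xs → y ∈ xs → P x y ≡ true ⊎ P y x ≡ true
      pairwise-elim P (z ∷ xs) e (here refl) y∈ = inj₁ (all-elim (P z) (proj₁ (∧-elim {all (P z) (z ∷ xs)} e)) y∈)
      pairwise-elim P (z ∷ xs) e (there x∈) (here refl) =
        inj₂ (all-elim (P z) (proj₁ (∧-elim {all (P z) (z ∷ xs)} e)) (there x∈))
      pairwise-elim P (z ∷ xs) e (there x∈) (there y∈) =
        pairwise-elim P xs (proj₂ (∧-elim {all (P z) (z ∷ xs)} e)) x∈ y∈

      solved-dominated : NoDomination → ∀ {k Γ} → All (Solved (Colourable S 4)) Γ → (s : Shape (suc k)) → ∀ u v os →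
        checkDominated Γ s u v os ≡ true → Solved (Colourable S 4) (_ , s)
      solved-dominated nd {k} sols s u v os e xs conf
        with ∧-elim {not (edge s u v)} e
      ... | e₁ , e₂ with ∧-elim {any (λ w → edge s v w ∧ not (edge s u w)) (allFin (suc k))} e₂
      ...   | e₃ , e₄ with any-elim _ (allFin (suc k)) e₃
      ...     | w , _ , e₅ with ∧-elim {edge s v w} e₅
      ...       | vw , uw with nd (lookup xs u) (lookup xs v) (Conf-∈ s conf u) (Conf-∈ s conf v) u≢v
                              (trans (sym (edge-sound s conf u v)) (not-elim e₁))
                  where
                    u≢v : lookup xs u ≢ lookup xs v
                    u≢v eq = true≢false vw (trans (edge-sound s conf v w)
                      (trans (cong (λ z → adj z (lookup xs w)) (sym eq))
                        (trans (sym (edge-sound s conf u w)) (not-elim uw))))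
      ...         | x , x∈ , ux , vx with ∨-elim (all-elim _ e₄ (rows-complete s conf x∈))
      ...           | inj₂ cov = covered-sound sols os (_ ▹ s) (x∈ , refl , conf) cov
      ...           | inj₁ neg = ⊥-elim (true≢false
                       (∧-intro (trans (lookup-map u (adj x) xs) (adj-sym ux))
                                (not-intro (trans (lookup-map v (adj x) xs) (adj-sym vx))))
                       (not-elim neg))

      solved-coloured : ∀ {k Γ} → All (Solved (Colourable S 4)) Γ → (s : Shape (suc k)) → ∀ c os os′ →
        checkColoured Γ s c os′ (types Γ os s) ≡ true → Solved (Colourable S 4) (_ , s)
      solved-coloured {k} {Γ} sols s c os os′ e xs conf
        with any? (λ x → S x ∧ covered Γ os (Vec.map (adj x) xs ▹ s) ≟ᵇ true)
      ... | yes (x , ex) = let x∈ , cov = ∧-elim ex in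
            covered-sound sols os (_ ▹ s) (x∈ , refl , conf) cov
      -- An adjacent pair that completes `s` to a solved shape yields the goal whatever its colours.
      -- Only in the absence of such pairs must the colouring by rows be proper.
      ... | no ¬cov with any? (λ u → any? (λ v → S u ∧ (S v ∧ (adj v u ∧
                covered Γ os′ ((true ∷ Vec.map (adj v) xs) ▹ Vec.map (adj u) xs ▹ s))) ≟ᵇ true))
      ...   | yes (u , v , ex) =
              let u∈ , e₁ = ∧-elim ex
                  v∈ , e₂ = ∧-elim e₁
                  vu , cov = ∧-elim e₂ in
              covered-sound sols os′ (_ ▹ _ ▹ s)
                {v ∷ u ∷ xs} (v∈ , cong (_∷ Vec.map (adj v) xs) vu , u∈ , refl , conf) cov
      ...   | no ¬cov₂ = col , (λ v _ → colourIn-< ts c _) , proper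
        where
          ts = types Γ os s
          row : V → Row (suc k)
          row x = Vec.map (adj x) xs
          col : V → ℕ
          col x = colourIn ts c (row x)
          typed : ∀ x → x ∈ₛ S → row x ∈ ts
          typed x x∈ = filterᵇ-intro _ (rows-complete s conf x∈)
            (not-intro (case bool-dec (covered Γ os (row x ▹ s)) of λ where
              (inj₁ t) → ⊥-elim (¬cov (x , ∧-intro x∈ t))
              (inj₂ f) → f))
          noClash : ∀ u v → u ∈ₛ S → v ∈ₛ S → adj v u ≡ true → col u ≡ col v →
            clash Γ os′ s (row u , col u) (row v , col v) ≡ true → ⊥
          noClash u v u∈ v∈ vu eq e with ∨-elim {not (col u ≡ᵇ col v)} e
          ... | inj₁ ne = true≢false (T⇒true (≡⇒≡ᵇ (col u) (col v) eq)) (not-elim ne)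
            where
              T⇒true : ∀ {b} → T b → b ≡ true
              T⇒true {true} _ = refl
          ... | inj₂ e′ with ∨-elim {refuted (true ∷ row v) (row u ▹ s)} e′
          ...   | inj₁ r = true≢false r
                    (subst (λ b → refuted (b ∷ row v) (row u ▹ s) ≡ false) vu
                      (refuted-sound (row u ▹ s) {u ∷ xs} (u∈ , refl , conf) v∈))
          ...   | inj₂ cov = ¬cov₂ (u , v , ∧-intro u∈ (∧-intro v∈ (∧-intro vu cov)))
          proper : ∀ u v → u ∈ₛ S → v ∈ₛ S → adj u v ≡ true → col u ≢ col v
          proper u v u∈ v∈ uv eq
            with pairwise-elim (clash Γ os′ s) _ e (∈-map⁺ _ (typed u u∈)) (∈-map⁺ _ (typed v v∈))
          ... | inj₁ t = noClash u v u∈ v∈ (adj-sym uv) eq t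
          ... | inj₂ t = noClash v u v∈ u∈ uv (sym eq) t

      run-sound : NoDomination → ∀ steps {Γ} → All (Solved (Colourable S 4)) Γ → run Γ steps ≡ true →
        All (Solved (Colourable S 4)) (derive Γ steps)
      run-sound nd []                sols e = sols
      run-sound nd ((l , R) ∷ steps) {Γ} sols e =
        let e₁ , e₂ = ∧-elim {check Γ (shapeOf l) R} e in
        run-sound nd steps (step (shapeOf l) R e₁ ∷ sols) e₂
        where
          step : ∀ {k} (s : Shape k) R → check Γ s R ≡ true → Solved (Colourable S 4) (_ , s)
          step {suc k} s (dominated a b os)    = solved-dominated nd sols s (clamp a) (clamp b) os
          step {suc k} s (coloured c os os′) = solved-coloured sols s c os os′

      derivable : NoDomination → ∀ {Γ steps} → Checked Γ steps → All (Solved (Colourable S 4)) Γ →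
        All (Solved (Colourable S 4)) (derive Γ steps)
      derivable nd {steps = steps} c sols = run-sound nd steps sols (Checked.passes c)

  -- Assembling colourings

  Colourable-mono : ∀ {S k l} → k ≤ l → Colourable S k → Colourable S l
  Colourable-mono k≤l (c , c< , proper) = c , (λ v v∈ → <-≤-trans (c< v v∈) k≤l) , proper

  Colourable-⊆ : ∀ {S S′ k} → S ⊆ₛ S′ → Colourable S′ k → Colourable S k
  Colourable-⊆ sub (c , c< , proper) =
    c , (λ v v∈ → c< v (sub v∈)) , λ u v u∈ v∈ → proper u v (sub u∈) (sub v∈)

  Independent : Sub → Set
  Independent S = ∀ u v → u ∈ₛ S → v ∈ₛ S → adj u v ≡ true → ⊥

  Colourable-independent : ∀ {S} → Independent S → Colourable S 1
  Colourable-independent ind = (λ _ → 0) , (λ _ _ → s≤s z≤n) , λ u v u∈ v∈ e _ → ind u v u∈ v∈ e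

  Colourable-split : ∀ {S k l} (P : V → Bool) → Colourable (S ∩ P) k → Colourable (S ∖ P) l → Colourable S (k + l)
  Colourable-split {S} {k} {l} P (c , c< , pc) (d , d< , pd) = e , e< , pe
    where
      e : V → ℕ
      e v = if P v then c v else k + d v
      e< : ∀ v → v ∈ₛ S → e v < k + l
      e< v v∈ with P v in eq
      ... | true  = <-≤-trans (c< v (∧-intro v∈ eq)) (m≤m+n k l)
      ... | false = +-monoʳ-< k (d< v (∧-intro v∈ (not-intro eq)))
      pe : ∀ u v → u ∈ₛ S → v ∈ₛ S → adj u v ≡ true → e u ≢ e v
      pe u v u∈ v∈ uv with P u in equ | P v in eqv
      ... | true  | true  = pc u v (∧-intro u∈ equ) (∧-intro v∈ eqv) uv
      ... | true  | false = <⇒≢ (<-≤-trans (c< u (∧-intro u∈ equ)) (m≤m+n k (d v)))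
      ... | false | true  = λ q → <⇒≢ (<-≤-trans (c< v (∧-intro v∈ eqv)) (m≤m+n k (d u))) (sym q)
      ... | false | false = λ q → pd u v (∧-intro u∈ (not-intro equ)) (∧-intro v∈ (not-intro eqv)) uv (+-cancelˡ-≡ k _ _ q)

  ∩-⊆ : ∀ {S P} → S ∩ P ⊆ₛ S
  ∩-⊆ v∈ = proj₁ (∧-elim v∈)

  Clique-uncons : ∀ {m S} → Clique (suc m) S → Σ V λ u → u ∈ₛ S × Clique m (S ∩ adj u)
  Clique-uncons (φ , φ∈ , φ~) = φ zero , φ∈ zero ,
    (φ ∘ suc) , (λ i → ∧-intro (φ∈ (suc i)) (φ~ zero (suc i) λ ())) , λ i j i≢j → φ~ (suc i) (suc j) (i≢j ∘ suc-injective)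

  clique? : ∀ m S → Dec (Clique m S)
  clique? zero    S = yes ((λ ()) , (λ ()) , (λ ()))
  clique? (suc m) S = map′ (λ (u , u∈ , K) → Clique-cons {S = S} {S ∩ adj u} u u∈ (λ z → z) K) Clique-uncons
    (any? λ u → (S u ≟ᵇ true) ×-dec clique? m (S ∩ adj u))

  clique₂ : ∀ {S a b} → a ∈ₛ S → b ∈ₛ S → adj a b ≡ true → Clique 2 S
  clique₂ {S} {a} {b} a∈ b∈ ab = Clique-cons {S = S} {S ∩ adj a} a a∈ (λ z → z)
    ((λ _ → b) , (λ _ → ∧-intro b∈ ab) , λ where zero zero ne → ⊥-elim (ne refl))

  clique₃ : ∀ {S a b c} → a ∈ₛ S → b ∈ₛ S → c ∈ₛ S →
    adj a b ≡ true → adj a c ≡ true → adj b c ≡ true → Clique 3 S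
  clique₃ {S} {a} a∈ b∈ c∈ ab ac bc = Clique-cons {S = S} {S ∩ adj a} a a∈ (λ z → z)
    (clique₂ (∧-intro b∈ ab) (∧-intro c∈ ac) bc)

  clique₄ : ∀ {S a b c d} → a ∈ₛ S → b ∈ₛ S → c ∈ₛ S → d ∈ₛ S → adj a b ≡ true → adj a c ≡ true →
    adj a d ≡ true → adj b c ≡ true → adj b d ≡ true → adj c d ≡ true → Clique 4 S
  clique₄ {S} {a} a∈ b∈ c∈ d∈ ab ac ad bc bd cd = Clique-cons {S = S} {S ∩ adj a} a a∈ (λ z → z)
    (clique₃ (∧-intro b∈ ab) (∧-intro c∈ ac) (∧-intro d∈ ad) bc bd cd)

  EdgeIn : Sub → Set
  EdgeIn S = Σ V λ u → Σ V λ v → u ∈ₛ S × v ∈ₛ S × adj u v ≡ true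

  edge-or-independent : ∀ S → EdgeIn S ⊎ Independent S
  edge-or-independent S with any? (λ u → any? (λ v → S u ∧ (S v ∧ adj u v) ≟ᵇ true))
  ... | yes (u , v , e) = inj₁ (u , v , proj₁ (∧-elim e) , proj₁ (∧-elim (proj₂ (∧-elim {S u} e))) ,
                                 proj₂ (∧-elim {S v} (proj₂ (∧-elim {S u} e))))
  ... | no ¬e = inj₂ λ u v u∈ v∈ uv → ¬e (u , v , ∧-intro u∈ (∧-intro v∈ uv))

  neighbours-independent : ∀ {S u} → ¬ Clique 3 S → u ∈ₛ S → Independent (S ∩ adj u)
  neighbours-independent {S} ¬K u∈ a b a∈ b∈ ab =
    let a∈S , ua = ∧-elim a∈
        b∈S , ub = ∧-elim b∈ in
    ¬K (clique₃ u∈ a∈S b∈S ua ub ab)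

  matching-far : ∀ {S p u v} → ¬ Matching (suc p) S → u ∈ₛ S → v ∈ₛ S → adj u v ≡ true → ¬ Matching p (S ∩ far u v)
  matching-far ¬M u∈ v∈ uv M = ¬M (_ , _ , u∈ , v∈ , uv , M)

  far-independent : ∀ {S u v} → ¬ Matching 2 S → u ∈ₛ S → v ∈ₛ S → adj u v ≡ true → Independent (S ∩ far u v)
  far-independent ¬M u∈ v∈ uv a b a∈ b∈ ab = matching-far ¬M u∈ v∈ uv (a , b , a∈ , b∈ , ab , tt)

  -- Without triangles both neighbourhoods are independent and take one colour each; whatever lies
  -- outside them is far.
  Colourable-around-edge : ∀ {S k u v} → ¬ Clique 3 S → u ∈ₛ S → v ∈ₛ S →
    Colourable (S ∩ far u v) k → Colourable S (2 + k)
  Colourable-around-edge {S} {k} {u} {v} ¬K u∈ v∈ C =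
    Colourable-split (adj u) (Colourable-independent (neighbours-independent ¬K u∈))
      (Colourable-split (adj v)
        (Colourable-independent λ a b a∈ b∈ ab →
          neighbours-independent ¬K v∈ a b (shrink a∈) (shrink b∈) ab)
        (Colourable-⊆ rest C))
    where
      shrink : ∀ {a} → a ∈ₛ S ∖ adj u ∩ adj v → a ∈ₛ S ∩ adj v
      shrink {a} a∈ = let b , c = ∧-elim {S a ∧ not (adj u a)} a∈ in ∧-intro (proj₁ (∧-elim {S a} b)) c
      rest : S ∖ adj u ∖ adj v ⊆ₛ S ∩ far u v
      rest {a} a∈ = let b , c = ∧-elim {S a ∧ not (adj u a)} a∈
                        d , e = ∧-elim {S a} b in ∧-intro d (∧-intro e c)

  triangle-free-2K₂-free : ∀ {S} → ¬ Clique 3 S → ¬ Matching 2 S → Colourable S 3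
  triangle-free-2K₂-free {S} ¬K ¬M with edge-or-independent S
  ... | inj₁ (u , v , u∈ , v∈ , uv) =
        Colourable-around-edge ¬K u∈ v∈ (Colourable-independent (far-independent ¬M u∈ v∈ uv))
  ... | inj₂ ind = Colourable-mono (s≤s z≤n) (Colourable-independent ind)

  -- Minimal counterexamples

  module _ where
    open Configurations

    -- A vertex whose neighbourhood is contained in that of a non-neighbour may inherit its colour.
    minimal-counterexample : ∀ {k} (P : Sub → Set) → (∀ {S S′} → S′ ⊆ₛ S → P S → P S′) →
      (∀ S → P S → NoDomination S → Colourable S k) → ∀ S → P S → Colourable S k
    minimal-counterexample {k} P hereditary crit S PS = go (suc (count S)) S ≤-refl PS
      where
        go : ∀ b S → count S < b → P S → Colourable S k
        go (suc b) S (s≤s lt) PS with any? (λ u → any? (λ v → (S u ∧ (S v ∧ (not ⌊ u ≟ᶠ v ⌋ ∧ not (adj u v))) ≟ᵇ true)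
             ×-dec all? (λ x → S x ∧ (adj u x ∧ not (adj v x)) ≟ᵇ false)))
        ... | no none = crit S PS nd
          where
            nd : NoDomination S
            nd u v u∈ v∈ u≢v uv with findᵇ (λ x → S x ∧ (adj u x ∧ not (adj v x)))
            ... | inj₁ (x , e) = let x∈ , e′ = ∧-elim e
                                     ux , vx = ∧-elim {adj u x} e′ in x , x∈ , ux , not-elim vx
            ... | inj₂ f = ⊥-elim (none (u , v , ∧-intro u∈ (∧-intro v∈ (∧-intro (distinct (u ≟ᶠ v)) (not-intro uv))) , f))
              where
                distinct : (d : Dec (u ≡ v)) → not ⌊ d ⌋ ≡ true
                distinct (yes e) = ⊥-elim (u≢v e)
                distinct (no _)  = refl
        ... | yes (u , v , e , dom) = c′ , c′< , proper′
          where
            u∈ : u ∈ₛ S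
            u∈ = proj₁ (∧-elim e)
            e₁ = proj₂ (∧-elim {S u} e)
            v∈ : v ∈ₛ S
            v∈ = proj₁ (∧-elim e₁)
            e₂ = proj₂ (∧-elim {S v} e₁)
            is-u : V → Bool
            is-u x = ⌊ x ≟ᶠ u ⌋
            u-is-u : is-u u ≡ true
            u-is-u with u ≟ᶠ u
            ... | yes _ = refl
            ... | no ne = ⊥-elim (ne refl)
            v-isn't-u : is-u v ≡ false
            v-isn't-u with v ≟ᶠ u
            ... | no _ = refl
            ... | yes refl = ⊥-elim (true≢false u-is-u (not-elim (proj₁ (∧-elim {not ⌊ u ≟ᶠ u ⌋} e₂))))
            rec : Colourable (S ∖ is-u) k
            rec = go b (S ∖ is-u)
              (<-≤-trans (count-< (λ x x∈ → proj₁ (∧-elim x∈)) u u∈ (trans (cong₂ _∧_ u∈ (cong not u-is-u)) refl)) lt)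
              (hereditary {S} {S ∖ is-u} (λ x∈ → proj₁ (∧-elim x∈)) PS)
            c = proj₁ rec
            c′ : V → ℕ
            c′ x = if is-u x then c v else c x
            v∈′ : v ∈ₛ S ∖ is-u
            v∈′ = ∧-intro v∈ (not-intro v-isn't-u)
            c′< : ∀ x → x ∈ₛ S → c′ x < k
            c′< x x∈ with is-u x in eq
            ... | true  = proj₁ (proj₂ rec) v v∈′
            ... | false = proj₁ (proj₂ rec) x (∧-intro x∈ (not-intro eq))
            inherited : ∀ y → y ∈ₛ S → is-u y ≡ false → adj u y ≡ true → c v ≢ c y
            inherited y y∈ ey uy with bool-dec (adj v y)
            ... | inj₁ vy = proj₂ (proj₂ rec) v y v∈′ (∧-intro y∈ (not-intro ey)) vy
            ... | inj₂ vy = ⊥-elim (true≢false (∧-intro y∈ (∧-intro uy (not-intro vy))) (dom y))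
            is-u-elim : ∀ x → is-u x ≡ true → x ≡ u
            is-u-elim x eq with x ≟ᶠ u
            ... | yes q = q
            proper′ : ∀ x y → x ∈ₛ S → y ∈ₛ S → adj x y ≡ true → c′ x ≢ c′ y
            proper′ x y x∈ y∈ xy with is-u x in ex | is-u y in ey
            ... | true  | true  = ⊥-elim (adj-irrefl xy (trans (is-u-elim x ex) (sym (is-u-elim y ey))))
            ... | true  | false = inherited y y∈ ey (subst (λ z → adj z y ≡ true) (is-u-elim x ex) xy)
            ... | false | true  = λ q → inherited x x∈ ex (adj-sym (subst (λ z → adj x z ≡ true) (is-u-elim y ey) xy)) (sym q)
            ... | false | false = proj₂ (proj₂ rec) x y (∧-intro x∈ (not-intro ex)) (∧-intro y∈ (not-intro ey)) xy

  -- From solved shapes to forbidden ones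

  module Excluding (S : Sub) (q p : ℕ) (¬K : ¬ Clique (suc q) S) (¬M : ¬ Matching (suc p) S) where
    open Configurations S
    open Proofs q p ¬K ¬M
    open Search q p

    conf? : ∀ {k} (s : Shape k) → Dec (Σ (Vec V k) (Conf s))
    conf? s = map′ (λ (xs , c , _) → xs , c) (λ (xs , c) → xs , c , tt) (go s (λ _ → ⊤) λ _ → yes tt)
      where
        -- `P` collects the conditions on the newer vertices, so that the oldest vertex is fixed
        -- first.
        go : ∀ {k} (s : Shape k) (P : Vec V k → Set) → (∀ xs → Dec (P xs)) → Dec (Σ (Vec V k) λ xs → Conf s xs × P xs)
        go ∅       P P? = map′ (λ p → [] , tt , p) (λ { ([] , _ , p) → p }) (P? [])
        go (r ▹ s) P P? =
          map′ (λ (xs , c , x , x∈ , e , p) → x ∷ xs , (x∈ , e , c) , p)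
               (λ { (x ∷ xs , (x∈ , e , c) , p) → xs , c , x , x∈ , e , p })
               (go s (λ xs → Σ V λ x → x ∈ₛ S × Vec.map (adj x) xs ≡ r × P (x ∷ xs))
                 (λ xs → any? λ x → (S x ≟ᵇ true) ×-dec (≡-decᵛ _≟ᵇ_ (Vec.map (adj x) xs) r ×-dec P? (x ∷ xs))))

    -- Either some solved shape occurs and the goal is reached at once, or from here on all of them
    -- may be treated as forbidden.
    avoid : ∀ {Goal : Set} {Γ} → All (Solved Goal) Γ → Goal ⊎ All (Solved ⊥) Γ
    avoid []             = inj₂ []
    avoid {Γ = (k , B) ∷ _} (sol ∷ sols) with conf? B | avoid sols
    ... | yes (xs , c) | _       = inj₁ (sol xs c)
    ... | no _         | inj₁ g  = inj₁ g
    ... | no ¬c        | inj₂ av = inj₂ ((λ xs c → ¬c (xs , c)) ∷ av)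

    module _ {Γ} (av : All (Solved ⊥) Γ) (os : List Occurrence) where

      excluded : ∀ {k} → Shape (suc k) → Row (suc k) → Bool
      excluded s r = refuted r s ∨ covered Γ os (r ▹ s)

      excluded-sound : ∀ {k} (s : Shape (suc k)) {xs x r} → Conf s xs → x ∈ₛ S → Vec.map (adj x) xs ≡ r →
        excluded s r ≡ true → ⊥
      excluded-sound s {xs} {x} c x∈ refl e with ∨-elim {refuted (Vec.map (adj x) xs) s} e
      ... | inj₁ r   = true≢false r (refuted-sound s c x∈)
      ... | inj₂ cov = covered-sound av os (_ ▹ s) (x∈ , refl , c) cov

      type∈ : ∀ {k} (s : Shape (suc k)) {xs x} → Conf s xs → x ∈ₛ S → Vec.map (adj x) xs ∈ types Γ os s
      type∈ s c x∈ = filterᵇ-intro _ (rows-complete s c x∈)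
        (not-intro ([ (λ t → ⊥-elim (covered-sound av os (_ ▹ s) (x∈ , refl , c) t)) , (λ f → f) ]′ (bool-dec _)))

  -- Colouring around a pentagon without K₄ and 2K₂

  module Pentagon (S : Sub) (¬K : ¬ Clique 4 S) (¬M : ¬ Matching 2 S)
    (av : All (Configurations.Proofs.Solved S 3 1 ¬K ¬M ⊥) pentagonLemmas)
    (xs : Vec V 5) (conf : Configurations.Conf S (proj₂ pentagon) xs) where
    open Configurations S
    open Excluding S 3 1 ¬K ¬M
    open Search 3 1

    C₅ : Shape 5
    C₅ = proj₂ pentagon

    -- In the complement the ten parts are cliques in circular order: parts at distance at most one are
    -- complete to each other, parts at distance at least four anticomplete. Even parts consist of the
    -- vertices with two neighbours on the pentagon, odd parts of those with three.
    part : Fin 10 → Row 5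
    part k = bitsOf 5 (lookup (9 ∷ 11 ∷ 10 ∷ 26 ∷ 18 ∷ 22 ∷ 20 ∷ 21 ∷ 5 ∷ 13 ∷ []) k)

    row : V → Row 5
    row x = Vec.map (adj x) xs

    P : ℕ → V → Bool
    P k x = S x ∧ (row x == part (clamp k))

    P-elim : ∀ k {x} → P k x ≡ true → x ∈ₛ S × row x ≡ part (clamp k)
    P-elim k e = let a , b = ∧-elim e in a , ==-sound _ _ b

    place : ∀ {x} → x ∈ₛ S → any (λ k → row x == part k) (allFin 10) ≡ true
    place x∈ = all-elim (λ r → any (λ k → r == part k) (allFin 10)) {types pentagonLemmas pentagonOccurrences C₅} refl
      (type∈ av pentagonOccurrences C₅ conf x∈)

    pairExcluded : ℕ → ℕ → Bool → Bool
    pairExcluded i j b = excluded av pentagonOccurrences (part (clamp j) ▹ C₅) (b ∷ part (clamp i))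

    pair : ∀ i j {b x y} → pairExcluded i j b ≡ true → P i x ≡ true → P j y ≡ true → adj x y ≡ b → ⊥
    pair i j e px py refl =
      let x∈ , rx = P-elim i px
          y∈ , ry = P-elim j py in
      excluded-sound av pentagonOccurrences _ (y∈ , ry , conf) x∈ (cong (_ ∷_) rx) e

    apart : ∀ i j {x y} → pairExcluded i j true ≡ true → P i x ≡ true → P j y ≡ true → adj x y ≡ false
    apart i j e px py = [ (λ t → ⊥-elim (pair i j e px py t)) , (λ f → f) ]′ (bool-dec _)

    joined : ∀ i j {x y} → pairExcluded i j false ≡ true → P i x ≡ true → P j y ≡ true → adj x y ≡ true
    joined i j e px py = [ (λ t → t) , (λ f → ⊥-elim (pair i j e px py f)) ]′ (bool-dec _)

    -- The arc property, read in the complement: a vertex of part `i` that meets some vertex of part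
    -- `j` also meets the vertices of a part `k` between them.
    triple : ∀ i j k {x y z} →
      pairExcluded k j true ∧ excluded av pentagonOccurrences ((false ∷ part (clamp k)) ▹ part (clamp j) ▹ C₅) (true ∷ false ∷ part (clamp i)) ≡ true →
      P i x ≡ true → P j y ≡ true → P k z ≡ true → adj x y ≡ false → adj x z ≡ true → ⊥
    triple i j k {x} {y} {z} e px py pz xy xz =
      let e₁ , e₂ = ∧-elim {pairExcluded k j true} e
          x∈ , rx = P-elim i px
          y∈ , ry = P-elim j py
          z∈ , rz = P-elim k pz in
      excluded-sound av pentagonOccurrences _
        (z∈ , cong₂ _∷_ (apart k j e₁ pz py) rz , y∈ , ry , conf) x∈
        (cong₂ _∷_ xz (cong₂ _∷_ xy rx)) e₂

    member-row : ∀ i → row (lookup xs i) ≡ Vec.tabulate (edge C₅ i)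
    member-row i = trans (cong (Vec.map (adj (lookup xs i))) (sym (tabulate∘lookup xs)))
      (trans (sym (tabulate-∘ (adj (lookup xs i)) (lookup xs)))
        (tabulate-cong (λ j → sym (edge-sound C₅ conf i j))))

    two : V
    two = lookup xs (suc (suc zero))

    -- Pentagon vertex 2 sees exactly 1 and 3, which is the mask 10. With part 2 inhabited, being
    -- complete to it in the complement is not vacuous, and the arc property applies.
    two∈P₂ : P 2 two ≡ true
    two∈P₂ = ∧-intro (Conf-∈ C₅ conf (suc (suc zero)))
      (trans (cong (_== part (clamp 2)) (member-row (suc (suc zero)))) refl)

    -- Four cliques of the complement, found by sweeping once around the circle.
    meets₂ misses₂ Q L₀ L₁ L₂ : V → Bool
    meets₂  x = exists (λ d → P 2 d ∧ not (adj x d))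
    misses₂ x = exists (λ d → P 2 d ∧ adj x d)
    Q x = (P 4 x ∨ P 5 x) ∧ misses₂ x
    L₀ x = P 0 x ∨ (P 1 x ∨ (P 9 x ∧ meets₂ x))
    L₁ x = P 2 x ∨ (P 3 x ∨ ((P 4 x ∨ P 5 x) ∧ not (misses₂ x)))
    L₂ x = Q x ∨ ((P 6 x ∨ P 7 x) ∧ not (exists (λ b → Q b ∧ adj x b)))

    -- The names `meets₂` and `misses₂` refer to the complement: to miss is to be adjacent in the
    -- graph.
    complete₂ : ∀ {x d} → not (misses₂ x) ≡ true → P 2 d ≡ true → adj x d ≡ false
    complete₂ {x} {d} e pd = [ (λ t → ⊥-elim (true≢false (∧-intro pd t) (not-exists _ (not-elim e) d))) , (λ f → f) ]′
      (bool-dec (adj x d))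

    two-cliques : ∀ i j → pairExcluded i i true ∧ (pairExcluded i j true ∧ (pairExcluded j i true ∧ pairExcluded j j true)) ≡ true →
      ∀ {u v} → P i u ∨ P j u ≡ true → P i v ∨ P j v ≡ true → adj u v ≡ true → ⊥
    two-cliques i j e u∈ v∈ uv =
      let e₁ , r₁ = ∧-elim {pairExcluded i i true} e
          e₂ , r₂ = ∧-elim {pairExcluded i j true} r₁
          e₃ , e₄ = ∧-elim {pairExcluded j i true} r₂ in
      [ (λ a → [ (λ b → pair i i e₁ a b uv) , (λ b → pair i j e₂ a b uv) ]′ (∨-elim v∈))
      , (λ a → [ (λ b → pair j i e₃ a b uv) , (λ b → pair j j e₄ a b uv) ]′ (∨-elim v∈)) ]′ (∨-elim u∈)

    -- Parts 9 and 1 are not consecutive, but an arc from part 9 that reaches part 2 runs over all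
    -- of part 1.
    L₀-independent : Independent (S ∩ L₀)
    L₀-independent u v u∈ v∈ uv = go (view (proj₂ (∧-elim {S u} u∈))) (view (proj₂ (∧-elim {S v} v∈)))
      where
        View : V → Set
        View x = (P 0 x ∨ P 1 x ≡ true) ⊎ (P 9 x ≡ true × meets₂ x ≡ true)
        view : ∀ {x} → L₀ x ≡ true → View x
        view {x} e with P 0 x | P 1 x
        ... | true  | _     = inj₁ refl
        ... | false | true  = inj₁ refl
        ... | false | false = inj₂ (∧-elim e)
        mixed : ∀ {x y} → P 9 x ≡ true → meets₂ x ≡ true → P 0 y ∨ P 1 y ≡ true → adj x y ≡ true → ⊥
        mixed {x} {y} p m q xy with ∨-elim q
        ... | inj₁ q₀ = pair 9 0 refl p q₀ xy
        ... | inj₂ q₁ = let d , e = exists-elim _ m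
                            pd , xd = ∧-elim {P 2 d} e in triple 9 2 1 refl p pd q₁ (not-elim xd) xy
        go : View u → View v → ⊥
        go (inj₁ a) (inj₁ b) = two-cliques 0 1 refl a b uv
        go (inj₁ a) (inj₂ (b , m)) = mixed b m a (adj-sym uv)
        go (inj₂ (a , m)) (inj₁ b) = mixed a m b uv
        go (inj₂ (a , _)) (inj₂ (b , _)) = pair 9 9 refl a b uv

    -- The critical pair is 5 and 3: an arc from part 5 that reaches `two` runs over part 3.
    L₁-independent : Independent (S ∩ L₁)
    L₁-independent u v u∈ v∈ uv = go (view (proj₂ (∧-elim {S u} u∈))) (view (proj₂ (∧-elim {S v} v∈)))
      where
        View : V → Set
        View x = (P 2 x ∨ P 3 x ≡ true) ⊎ (P 4 x ∨ P 5 x ≡ true × not (misses₂ x) ≡ true)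
        view : ∀ {x} → L₁ x ≡ true → View x
        view {x} e with P 2 x | P 3 x
        ... | true  | _     = inj₁ refl
        ... | false | true  = inj₁ refl
        ... | false | false = inj₂ (∧-elim e)
        mixed : ∀ {x y} → P 4 x ∨ P 5 x ≡ true → not (misses₂ x) ≡ true → P 2 y ∨ P 3 y ≡ true → adj x y ≡ true → ⊥
        mixed p m q xy with ∨-elim q
        ... | inj₁ q₂ = true≢false xy (complete₂ m q₂)
        ... | inj₂ q₃ with ∨-elim p
        ...   | inj₁ p₄ = pair 4 3 refl p₄ q₃ xy
        ...   | inj₂ p₅ = triple 5 2 3 refl p₅ two∈P₂ q₃ (complete₂ m two∈P₂) xy
        go : View u → View v → ⊥
        go (inj₁ a) (inj₁ b) = two-cliques 2 3 refl a b uv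
        go (inj₁ a) (inj₂ (b , m)) = mixed b m a (adj-sym uv)
        go (inj₂ (a , m)) (inj₁ b) = mixed a m b uv
        go (inj₂ (a , _)) (inj₂ (b , _)) = two-cliques 4 5 refl a b uv

    L₂-independent : Independent (S ∩ L₂)
    L₂-independent u v u∈ v∈ uv =
      go (∨-elim {Q u} (proj₂ (∧-elim {S u} u∈))) (∨-elim {Q v} (proj₂ (∧-elim {S v} v∈)))
      where
        Other : V → Bool
        Other x = (P 6 x ∨ P 7 x) ∧ not (exists (λ b → Q b ∧ adj x b))
        mixed : ∀ {x y} → Other x ≡ true → Q y ≡ true → adj x y ≡ true → ⊥
        mixed {x} {y} o q xy = true≢false (∧-intro q xy) (not-exists _ (not-elim (proj₂ (∧-elim {P 6 x ∨ P 7 x} o))) y)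
        go : Q u ≡ true ⊎ Other u ≡ true → Q v ≡ true ⊎ Other v ≡ true → ⊥
        go (inj₁ a) (inj₁ b) = two-cliques 4 5 refl (proj₁ (∧-elim a)) (proj₁ (∧-elim b)) uv
        go (inj₁ a) (inj₂ b) = mixed b a (adj-sym uv)
        go (inj₂ a) (inj₁ b) = mixed a b uv
        go (inj₂ a) (inj₂ b) = two-cliques 6 7 refl (proj₁ (∧-elim a)) (proj₁ (∧-elim b)) uv

    -- Left over are the vertices of parts 6 and 7 kept out of `L₂` by a neighbour in `Q`, and
    -- vertices of parts 8 and 9 adjacent to all of part 2: for part 8 by distance four, for part 9
    -- because the others went to `L₀`.
    L₃-independent : Independent (S ∖ L₀ ∖ L₁ ∖ L₂)
    L₃-independent u v u∈ v∈ uv = go (view u∈) (view v∈)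
      where
        Left Right View : V → Set
        Left  x = P 6 x ∨ P 7 x ≡ true × Σ V λ b → Q b ≡ true × adj x b ≡ true
        Right x = P 8 x ∨ P 9 x ≡ true × (∀ {d} → P 2 d ≡ true → adj x d ≡ true)
        View x = Left x ⊎ Right x
        view : ∀ {x} → x ∈ₛ S ∖ L₀ ∖ L₁ ∖ L₂ → View x
        view {x} x∈ with ∧-elim {((S ∖ L₀) ∖ L₁) x} x∈
        ... | x∈₁ , ¬L₂ with ∧-elim {(S ∖ L₀) x} x∈₁
        ...   | x∈₀ , ¬L₁ with ∧-elim {S x} x∈₀
        ...     | x∈S , ¬L₀ = classify (any-elim _ (allFin 10) (place x∈S))
          where
            not₀ : L₀ x ≡ false
            not₀ = not-elim ¬L₀
            not₁ : L₁ x ≡ false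
            not₁ = not-elim ¬L₁
            not₂ : L₂ x ≡ false
            not₂ = not-elim ¬L₂
            is : ∀ k → row x == part (clamp k) ≡ true → P k x ≡ true
            is k e = ∧-intro x∈S e
            middle : P 4 x ∨ P 5 x ≡ true → View x
            middle e with bool-dec (misses₂ x)
            ... | inj₁ m = ⊥-elim (true≢false (∨-introˡ (∧-intro e m)) not₂)
            ... | inj₂ m = ⊥-elim (true≢false (∨-introʳ (P 2 x) (∨-introʳ (P 3 x) (∧-intro e (not-intro m)))) not₁)
            left : P 6 x ∨ P 7 x ≡ true → View x
            left e with bool-dec (exists (λ b → Q b ∧ adj x b))
            ... | inj₁ t = let b , e′ = exists-elim _ t in inj₁ (e , b , ∧-elim {Q b} e′)
            ... | inj₂ f = ⊥-elim (true≢false (∨-introʳ (Q x) (∧-intro e (not-intro f))) not₂)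
            right₉ : P 9 x ≡ true → ∀ {d} → P 2 d ≡ true → adj x d ≡ true
            right₉ e {d} pd with bool-dec (adj x d)
            ... | inj₁ t = t
            ... | inj₂ f = ⊥-elim (true≢false
                    (∨-introʳ (P 0 x) (∨-introʳ (P 1 x) (∧-intro e (exists-intro _ d (∧-intro pd (not-intro f)))))) not₀)
            classify : (Σ (Fin 10) λ k → k ∈ allFin 10 × (row x == part k) ≡ true) → View x
            classify (zero , _ , e) = ⊥-elim (true≢false (∨-introˡ (is 0 e)) not₀)
            classify (suc zero , _ , e) = ⊥-elim (true≢false (∨-introʳ (P 0 x) (∨-introˡ (is 1 e))) not₀)
            classify (suc (suc zero) , _ , e) = ⊥-elim (true≢false (∨-introˡ (is 2 e)) not₁)
            classify (suc (suc (suc zero)) , _ , e) = ⊥-elim (true≢false (∨-introʳ (P 2 x) (∨-introˡ (is 3 e))) not₁)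
            classify (suc (suc (suc (suc zero))) , _ , e) = middle (∨-introˡ (is 4 e))
            classify (suc (suc (suc (suc (suc zero)))) , _ , e) = middle (∨-introʳ (P 4 x) (is 5 e))
            classify (suc (suc (suc (suc (suc (suc zero))))) , _ , e) = left (∨-introˡ (is 6 e))
            classify (suc (suc (suc (suc (suc (suc (suc zero)))))) , _ , e) = left (∨-introʳ (P 6 x) (is 7 e))
            classify (suc (suc (suc (suc (suc (suc (suc (suc zero))))))) , _ , e) =
              inj₂ (∨-introˡ (is 8 e) , joined 8 2 refl (is 8 e))
            classify (suc (suc (suc (suc (suc (suc (suc (suc (suc zero)))))))) , _ , e) =
              inj₂ (∨-introʳ (P 8 x) (is 9 e) , right₉ (is 9 e))
        -- x, y, b and a vertex of P₂ missed by b would form a K₄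
        crossing : ∀ {x y} → Left x → Right y → adj x y ≡ true → ⊥
        crossing {x} {y} (px , b , qb , xb) (py , y~P₂) xy =
          ¬K (clique₄ (∈67 px) (∈89 py) (∈45 pb) (proj₁ (P-elim 2 pd)) xy xb
               (x~d px) (y~b pb py px) (y~P₂ pd) bd)
          where
            pb = proj₁ (∧-elim {P 4 b ∨ P 5 b} qb)
            miss = exists-elim _ (proj₂ (∧-elim {P 4 b ∨ P 5 b} qb))
            d = proj₁ miss
            pd : P 2 d ≡ true
            pd = proj₁ (∧-elim {P 2 d} (proj₂ miss))
            bd : adj b d ≡ true
            bd = proj₂ (∧-elim {P 2 d} (proj₂ miss))
            ∈67 : ∀ {z} → P 6 z ∨ P 7 z ≡ true → z ∈ₛ S
            ∈67 e = [ proj₁ ∘ P-elim 6 , proj₁ ∘ P-elim 7 ]′ (∨-elim e)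
            ∈89 : ∀ {z} → P 8 z ∨ P 9 z ≡ true → z ∈ₛ S
            ∈89 e = [ proj₁ ∘ P-elim 8 , proj₁ ∘ P-elim 9 ]′ (∨-elim e)
            ∈45 : ∀ {z} → P 4 z ∨ P 5 z ≡ true → z ∈ₛ S
            ∈45 e = [ proj₁ ∘ P-elim 4 , proj₁ ∘ P-elim 5 ]′ (∨-elim e)
            x~d : P 6 x ∨ P 7 x ≡ true → adj x d ≡ true
            x~d e = [ (λ p → joined 6 2 refl p pd) , (λ p → joined 7 2 refl p pd) ]′ (∨-elim e)
            y~b : P 4 b ∨ P 5 b ≡ true → P 8 y ∨ P 9 y ≡ true → P 6 x ∨ P 7 x ≡ true → adj y b ≡ true
            y~b eb ey ex with ∨-elim {P 4 b} eb | ∨-elim {P 8 y} ey | ∨-elim {P 6 x} ex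
            ... | inj₁ b₄ | inj₁ y₈ | _ = joined 8 4 refl y₈ b₄
            ... | inj₁ b₄ | inj₂ y₉ | _ = joined 9 4 refl y₉ b₄
            ... | inj₂ b₅ | inj₂ y₉ | _ = joined 9 5 refl y₉ b₅
            ... | inj₂ b₅ | inj₁ y₈ | inj₁ x₆ = ⊥-elim (pair 6 5 refl x₆ b₅ xb)
            ... | inj₂ b₅ | inj₁ y₈ | inj₂ x₇ with bool-dec (adj y b)
            ...   | inj₁ t = t
            -- Distance three decides nothing by itself; but if `b` met `y` in the complement, it
            -- would run over part 7 and meet `x`.
            ...   | inj₂ f = ⊥-elim (triple 5 8 7 refl b₅ y₈ x₇ (adj-sym f) (adj-sym xb))
        go : View u → View v → ⊥
        go (inj₁ a) (inj₁ b) = two-cliques 6 7 refl (proj₁ a) (proj₁ b) uv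
        go (inj₁ a) (inj₂ b) = crossing a b uv
        go (inj₂ a) (inj₁ b) = crossing b a (adj-sym uv)
        go (inj₂ a) (inj₂ b) = two-cliques 8 9 refl (proj₁ a) (proj₁ b) uv

    colouring : Colourable S 4
    colouring =
      Colourable-split L₀ (Colourable-independent L₀-independent)
        (Colourable-split L₁ (Colourable-independent (thin L₁ L₁-independent))
          (Colourable-split L₂ (Colourable-independent λ u v u∈ v∈ → L₂-independent u v (thin₂ u∈) (thin₂ v∈))
            (Colourable-independent L₃-independent)))
      where
        thin : ∀ L → Independent (S ∩ L) → Independent (S ∖ L₀ ∩ L)
        thin L ind u v u∈ v∈ = ind u v (shrink u∈) (shrink v∈)
          where
            shrink : S ∖ L₀ ∩ L ⊆ₛ S ∩ L
            shrink {x} x∈ = let a , b = ∧-elim {(S ∖ L₀) x} x∈ in ∧-intro (∩-⊆ {S} {not ∘ L₀} a) b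
        thin₂ : S ∖ L₀ ∖ L₁ ∩ L₂ ⊆ₛ S ∩ L₂
        thin₂ {x} x∈ = let a , b = ∧-elim {(S ∖ L₀ ∖ L₁) x} x∈ in
          ∧-intro (∩-⊆ {S} {not ∘ L₀} (∩-⊆ {S ∖ L₀} {not ∘ L₁} a)) b

  -- Four colours without K₄ and 2K₂

  module K₄FreeCritical (S : Sub) (¬K : ¬ Clique 4 S) (¬M : ¬ Matching 2 S) (nd : Configurations.NoDomination S) where
    open Configurations S
    open Proofs 3 1 ¬K ¬M
    open Excluding S 3 1 ¬K ¬M
    open Search 3 1

    all-solved : All (Solved (Colourable S 4)) (derive [] pentagonSteps)
    all-solved = derivable nd pentagonSteps-checked []

    pentagonLemmas-solved : All (Solved (Colourable S 4)) pentagonLemmas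
    pentagonLemmas-solved = pick all-solved
      where
        pick : ∀ {a b c d e f g h Γ} → All (Solved (Colourable S 4)) (a ∷ b ∷ c ∷ d ∷ e ∷ f ∷ g ∷ h ∷ Γ) →
          All (Solved (Colourable S 4)) (h ∷ b ∷ a ∷ [])
        -- Counted from the end of `pentagonSteps`, these are the eighth, second and first shapes.
        pick (a ∷ b ∷ _ ∷ _ ∷ _ ∷ _ ∷ _ ∷ h ∷ _) = h ∷ b ∷ a ∷ []

    pentagon-solved : Solved (Colourable S 4) pentagon
    pentagon-solved xs conf = [ (λ c → c) , (λ av → Pentagon.colouring S ¬K ¬M av xs conf) ]′ (avoid pentagonLemmas-solved)

    -- This finishes the class: in the absence of a triangle three colours are enough.
    triangle-solved : Solved (Colourable S 4) (_ , shapeOf (3 ∷ 1 ∷ 0 ∷ []))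
    triangle-solved = All.head (derivable nd triangleSteps-checked (pentagon-solved ∷ []))

    colouring : Colourable S 4
    colouring with clique? 3 S
    ... | no ¬K₃ = Colourable-mono (s≤s (s≤s (s≤s z≤n))) (triangle-free-2K₂-free ¬K₃ ¬M)
    ... | yes (φ , φ∈ , φ~) = triangle-solved (φ zero ∷ φ (suc zero) ∷ φ (suc (suc zero)) ∷ [])
          (φ∈ _ , cong₂ _∷_ (φ~ _ _ λ ()) (cong (_∷ []) (φ~ _ _ λ ())) ,
           φ∈ _ , cong (_∷ []) (φ~ _ _ λ ()) , φ∈ _ , refl , tt)

  K₄-free-2K₂-free : ∀ S → ¬ Clique 4 S × ¬ Matching 2 S → Colourable S 4
  K₄-free-2K₂-free = minimal-counterexample (λ S → ¬ Clique 4 S × ¬ Matching 2 S)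
    (λ {S} {S′} sub (¬K , ¬M) → ¬K ∘ Clique-mono {S = S′} {S} sub , ¬M ∘ Matching-mono 2 {S′} {S} sub)
    (λ S (¬K , ¬M) nd → K₄FreeCritical.colouring S ¬K ¬M nd)

  -- Colouring around a pentagon and an edge without K₃ and 3K₂

  module PentagonEdge (S : Sub) (¬K : ¬ Clique 3 S) (¬M : ¬ Matching 3 S)
    (av : All (Configurations.Proofs.Solved S 2 2 ¬K ¬M ⊥) pentagonEdgeLemmas)
    (xs : Vec V 7) (conf : Configurations.Conf S pentagonEdge xs) where
    open Configurations S
    open Excluding S 2 2 ¬K ¬M
    open Search 2 2

    v u : V
    v = lookup xs zero
    u = lookup xs (suc zero)

    -- The vertices far from the edge uv form a blow-up of the pentagon with these five parts.
    part : Fin 5 → Row 7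
    part k = bitsOf 7 (lookup (36 ∷ 80 ∷ 40 ∷ 20 ∷ 72 ∷ []) k)

    row : V → Row 7
    row x = Vec.map (adj x) xs

    B : ℕ → V → Bool
    B k x = S x ∧ (row x == part (clamp k))

    B-elim : ∀ k {x} → B k x ≡ true → x ∈ₛ S × row x ≡ part (clamp k)
    B-elim k e = let a , b = ∧-elim e in a , ==-sound _ _ b

    -- Far from `uv`, a vertex without neighbours on the pentagon completes the excluded shape, and
    -- one with a single neighbour leaves a pentagon edge that gives 3K₂. Two adjacent neighbours
    -- would form a triangle.
    place : ∀ {x} → x ∈ₛ S → adj v x ≡ false → adj u x ≡ false → Σ (Fin 5) λ k → k ∈ allFin 5 × (row x == part k) ≡ true
    place {x} x∈ vx ux with ∨-elim {lookup (row x) zero ∨ lookup (row x) (suc zero)}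
      (all-elim (λ r → (lookup r zero ∨ lookup r (suc zero)) ∨ any (λ k → r == part k) (allFin 5))
        {types pentagonEdgeLemmas pentagonEdgeOccurrences pentagonEdge} refl
        (type∈ av pentagonEdgeOccurrences pentagonEdge conf x∈))
    ... | inj₂ e = any-elim _ (allFin 5) e
    ... | inj₁ e = ⊥-elim (true≢false e (cong₂ _∨_
            (trans (lookup-map zero (adj x) xs) (adj-sym vx)) (trans (lookup-map (suc zero) (adj x) xs) (adj-sym ux))))

    pairExcluded : ℕ → ℕ → Bool → Bool
    pairExcluded i j b = excluded av pentagonEdgeOccurrences (part (clamp j) ▹ pentagonEdge) (b ∷ part (clamp i))

    pair : ∀ i j {b x y} → pairExcluded i j b ≡ true → B i x ≡ true → B j y ≡ true → adj x y ≡ b → ⊥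
    pair i j e px py refl =
      let x∈ , rx = B-elim i px
          y∈ , ry = B-elim j py in
      excluded-sound av pentagonEdgeOccurrences _ (y∈ , ry , conf) x∈ (cong (_ ∷_) rx) e

    joined : ∀ i j {x y} → pairExcluded i j false ≡ true → B i x ≡ true → B j y ≡ true → adj x y ≡ true
    joined i j e px py = [ (λ t → t) , (λ f → ⊥-elim (pair i j e px py f)) ]′ (bool-dec _)

    meets : ℕ → V → Bool
    meets k x = exists (λ b → B k b ∧ adj x b)

    -- The blow-up is coloured by the parts 1, then 2 and 4, then 0 and 3. Each neighbour of `u`
    -- joins a class in which it has no neighbour: if it meets part 1 it avoids parts 0 and 2, if it
    -- meets part 4 it avoids part 3.
    L₀ L₂ : V → Bool
    L₀ x = (adj u x ∧ not (meets 1 x)) ∨ B 1 x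
    L₂ x = (adj u x ∧ (meets 1 x ∧ not (meets 4 x))) ∨ (B 2 x ∨ B 4 x)

    ¬meets : ∀ k {x b} → meets k x ≡ false → B k b ≡ true → adj x b ≡ true → ⊥
    ¬meets k {x} {b} m pb xb = true≢false (∧-intro pb xb) (not-exists _ m b)

    -- Consecutive parts are completely joined, so `x`, its neighbour in part `i` and `y` would form
    -- a triangle.
    blocked : ∀ i j {x y} → pairExcluded i j false ≡ true → x ∈ₛ S → meets i x ≡ true → B j y ≡ true → adj x y ≡ true → ⊥
    blocked i j {x} {y} e x∈ m py xy =
      let b , e′ = exists-elim _ m
          pb , xb = ∧-elim {B i b} e′ in
      ¬K (clique₃ x∈ (proj₁ (B-elim i pb)) (proj₁ (B-elim j py)) xb xy (joined i j e pb py))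

    near-u : ∀ {x y} → x ∈ₛ S → y ∈ₛ S → adj u x ≡ true → adj u y ≡ true → adj x y ≡ true → ⊥
    near-u x∈ y∈ ux uy xy = ¬K (clique₃ (Conf-∈ pentagonEdge conf (suc zero)) x∈ y∈ ux uy xy)

    L₀-independent : Independent (S ∩ L₀)
    L₀-independent x y x∈ y∈ xy with ∧-elim {S x} x∈ | ∧-elim {S y} y∈
    ... | x∈S , lx | y∈S , ly with ∨-elim lx | ∨-elim ly
    ...   | inj₁ a | inj₁ b = near-u x∈S y∈S (proj₁ (∧-elim a)) (proj₁ (∧-elim b)) xy
    ...   | inj₁ a | inj₂ b = ¬meets 1 (not-elim (proj₂ (∧-elim {adj u x} a))) b xy
    ...   | inj₂ a | inj₁ b = ¬meets 1 (not-elim (proj₂ (∧-elim {adj u y} b))) a (adj-sym xy)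
    ...   | inj₂ a | inj₂ b = pair 1 1 refl a b xy

    L₁-independent : Independent (S ∖ L₀ ∩ adj v)
    L₁-independent x y x∈ y∈ xy with ∧-elim {(S ∖ L₀) x} x∈ | ∧-elim {(S ∖ L₀) y} y∈
    ... | x∈S , vx | y∈S , vy =
      ¬K (clique₃ (Conf-∈ pentagonEdge conf zero) (∩-⊆ {S} {not ∘ L₀} x∈S) (∩-⊆ {S} {not ∘ L₀} y∈S) vx vy xy)

    L₂-independent : Independent (S ∩ L₂)
    L₂-independent x y x∈ y∈ xy with ∧-elim {S x} x∈ | ∧-elim {S y} y∈
    ... | x∈S , lx | y∈S , ly = go (∨-elim lx) (∨-elim ly)
      where
        X : V → Bool
        X z = adj u z ∧ (meets 1 z ∧ not (meets 4 z))
        mixed : ∀ {a b} → a ∈ₛ S → X a ≡ true → B 2 b ∨ B 4 b ≡ true → adj a b ≡ true → ⊥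
        mixed {a} a∈ e f ab =
          let _ , e′ = ∧-elim {adj u a} e
              m₁ , m₄ = ∧-elim {meets 1 a} e′ in
          [ (λ b₂ → blocked 1 2 refl a∈ m₁ b₂ ab) , (λ b₄ → ¬meets 4 (not-elim m₄) b₄ ab) ]′ (∨-elim f)
        go : X x ≡ true ⊎ B 2 x ∨ B 4 x ≡ true → X y ≡ true ⊎ B 2 y ∨ B 4 y ≡ true → ⊥
        go (inj₁ a) (inj₁ b) = near-u x∈S y∈S (proj₁ (∧-elim a)) (proj₁ (∧-elim b)) xy
        go (inj₁ a) (inj₂ b) = mixed x∈S a b xy
        go (inj₂ a) (inj₁ b) = mixed y∈S b a (adj-sym xy)
        go (inj₂ a) (inj₂ b) with ∨-elim a | ∨-elim b
        ... | inj₁ p | inj₁ q = pair 2 2 refl p q xy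
        ... | inj₁ p | inj₂ q = pair 2 4 refl p q xy
        ... | inj₂ p | inj₁ q = pair 4 2 refl p q xy
        ... | inj₂ p | inj₂ q = pair 4 4 refl p q xy

    L₃-independent : Independent (S ∖ L₀ ∖ adj v ∖ L₂)
    L₃-independent x y x∈ y∈ xy = go (view x∈) (view y∈)
      where
        X : V → Set
        X z = z ∈ₛ S × adj u z ≡ true × meets 1 z ≡ true × meets 4 z ≡ true
        View : V → Set
        View z = X z ⊎ (B 0 z ≡ true ⊎ B 3 z ≡ true)
        view : ∀ {z} → z ∈ₛ S ∖ L₀ ∖ adj v ∖ L₂ → View z
        view {z} z∈ with ∧-elim {((S ∖ L₀) ∖ adj v) z} z∈
        ... | z∈₁ , ¬L₂ with ∧-elim {(S ∖ L₀) z} z∈₁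
        ...   | z∈₀ , ¬v with ∧-elim {S z} z∈₀
        ...     | z∈S , ¬L₀ with bool-dec (adj u z)
        ...       | inj₁ uz = inj₁ (z∈S , uz , m₁ , m₄)
          where
            m₁ : meets 1 z ≡ true
            m₁ with bool-dec (meets 1 z)
            ... | inj₁ t = t
            ... | inj₂ f = ⊥-elim (true≢false (∨-introˡ (∧-intro uz (not-intro f))) (not-elim ¬L₀))
            m₄ : meets 4 z ≡ true
            m₄ with bool-dec (meets 4 z)
            ... | inj₁ t = t
            ... | inj₂ f = ⊥-elim (true≢false (∨-introˡ (∧-intro uz (∧-intro m₁ (not-intro f)))) (not-elim ¬L₂))
        ...       | inj₂ uz = classify (place z∈S (not-elim ¬v) uz)
          where
            classify : (Σ (Fin 5) λ k → k ∈ allFin 5 × (row z == part k) ≡ true) → View z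
            classify (zero , _ , e) = inj₂ (inj₁ (∧-intro z∈S e))
            classify (suc zero , _ , e) =
              ⊥-elim (true≢false (∨-introʳ (adj u z ∧ not (meets 1 z)) (∧-intro z∈S e)) (not-elim ¬L₀))
            classify (suc (suc zero) , _ , e) =
              ⊥-elim (true≢false (∨-introʳ (adj u z ∧ _) (∨-introˡ (∧-intro z∈S e))) (not-elim ¬L₂))
            classify (suc (suc (suc zero)) , _ , e) = inj₂ (inj₂ (∧-intro z∈S e))
            classify (suc (suc (suc (suc zero))) , _ , e) =
              ⊥-elim (true≢false (∨-introʳ (adj u z ∧ _) (∨-introʳ (B 2 z) (∧-intro z∈S e))) (not-elim ¬L₂))
        mixed : ∀ {a b} → X a → B 0 b ≡ true ⊎ B 3 b ≡ true → adj a b ≡ true → ⊥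
        mixed (a∈ , _ , m₁ , _) (inj₁ q) ab = blocked 1 0 refl a∈ m₁ q ab
        mixed (a∈ , _ , _ , m₄) (inj₂ q) ab = blocked 4 3 refl a∈ m₄ q ab
        go : View x → View y → ⊥
        go (inj₁ (a∈ , ua , _)) (inj₁ (b∈ , ub , _)) = near-u a∈ b∈ ua ub xy
        go (inj₁ a) (inj₂ b) = mixed a b xy
        go (inj₂ a) (inj₁ b) = mixed b a (adj-sym xy)
        go (inj₂ (inj₁ a)) (inj₂ (inj₁ b)) = pair 0 0 refl a b xy
        go (inj₂ (inj₁ a)) (inj₂ (inj₂ b)) = pair 0 3 refl a b xy
        go (inj₂ (inj₂ a)) (inj₂ (inj₁ b)) = pair 3 0 refl a b xy
        go (inj₂ (inj₂ a)) (inj₂ (inj₂ b)) = pair 3 3 refl a b xy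

    colouring : Colourable S 4
    colouring =
      Colourable-split L₀ (Colourable-independent L₀-independent)
        (Colourable-split (adj v) (Colourable-independent L₁-independent)
          (Colourable-split L₂ (Colourable-independent λ x y x∈ y∈ → L₂-independent x y (shrink x∈) (shrink y∈))
            (Colourable-independent L₃-independent)))
      where
        shrink : S ∖ L₀ ∖ adj v ∩ L₂ ⊆ₛ S ∩ L₂
        shrink {x} x∈ = let a , b = ∧-elim {(S ∖ L₀ ∖ adj v) x} x∈ in
          ∧-intro (∩-⊆ {S} {not ∘ L₀} (∩-⊆ {S ∖ L₀} {not ∘ adj v} a)) b

  -- Four colours without K₃ and 3K₂

  module _ where
    open Configurations

    -- The neighbours of `a` and of `b` go to different classes. The vertices far from `ab` are
    -- independent, and each joins the class of the neighbours of `b` exactly if it has a neighbour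
    -- among those of `a`.
    bipartite : ∀ {R} → ¬ Clique 3 R → ¬ Matching 2 R → ¬ Σ (Vec V 5) (Conf R (proj₂ pentagon)) → Colourable R 2
    bipartite {R} ¬K ¬M ¬C₅ with edge-or-independent R
    ... | inj₂ ind = Colourable-mono (s≤s z≤n) (Colourable-independent ind)
    ... | inj₁ (a , b , a∈ , b∈ , ab) =
          Colourable-split L (Colourable-independent L-independent) (Colourable-independent rest-independent)
      where
        meets : V → Bool
        meets x = exists (λ y → (R y ∧ adj a y) ∧ adj x y)
        L : V → Bool
        L x = adj a x ∨ (not (adj b x) ∧ not (meets x))
        ¬meets : ∀ {x y} → meets x ≡ false → y ∈ₛ R → adj a y ≡ true → adj x y ≡ true → ⊥
        ¬meets {y = y} m y∈ ay xy = true≢false (∧-intro (∧-intro y∈ ay) xy) (not-exists _ m y)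
        far-far : ∀ {x y} → x ∈ₛ R → y ∈ₛ R → adj a x ≡ false → adj b x ≡ false →
          adj a y ≡ false → adj b y ≡ false → adj x y ≡ true → ⊥
        far-far x∈ y∈ ax bx ay by xy = far-independent ¬M a∈ b∈ ab _ _
          (∧-intro x∈ (∧-intro (not-intro ax) (not-intro bx))) (∧-intro y∈ (∧-intro (not-intro ay) (not-intro by))) xy
        far-part : ∀ {z} → adj a z ≡ false → L z ≡ true → not (adj b z) ≡ true × not (meets z) ≡ true
        far-part {z} az lz rewrite az = ∧-elim lz
        L-independent : Independent (R ∩ L)
        L-independent x y x∈ y∈ xy with ∧-elim {R x} x∈ | ∧-elim {R y} y∈
        ... | x∈R , lx | y∈R , ly with bool-dec (adj a x) | bool-dec (adj a y)
        ...   | inj₁ ax | inj₁ ay = neighbours-independent ¬K a∈ x y (∧-intro x∈R ax) (∧-intro y∈R ay) xy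
        ...   | inj₁ ax | inj₂ ay = ¬meets (not-elim (proj₂ (far-part ay ly))) x∈R ax (adj-sym xy)
        ...   | inj₂ ax | inj₁ ay = ¬meets (not-elim (proj₂ (far-part ax lx))) y∈R ay xy
        ...   | inj₂ ax | inj₂ ay = far-far x∈R y∈R ax (not-elim (proj₁ (far-part ax lx))) ay (not-elim (proj₁ (far-part ay ly))) xy
        Rest : V → Set
        Rest x = x ∈ₛ R × adj a x ≡ false × (adj b x ≡ true ⊎ (adj b x ≡ false × meets x ≡ true))
        rest : ∀ {x} → x ∈ₛ R ∖ L → Rest x
        rest {x} x∈ with ∧-elim {R x} x∈
        ... | x∈R , ¬L with adj a x | adj b x | meets x
        ...   | false | true  | _    = x∈R , refl , inj₁ refl
        ...   | false | false | true = x∈R , refl , inj₂ (refl , refl)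
        -- x, a common neighbour w of x and a, then a, b, y form a pentagon
        crossing : ∀ {x y} → x ∈ₛ R → y ∈ₛ R → adj a x ≡ false → adj a y ≡ false → adj b x ≡ false → meets x ≡ true →
          adj b y ≡ true → adj x y ≡ true → ⊥
        crossing {x} {y} x∈ y∈ ax ay bx m by xy with exists-elim _ m
        ... | w , e with ∧-elim {R w ∧ adj a w} e
        ...   | e′ , xw with ∧-elim {R w} e′
        ...     | w∈ , aw = ¬C₅ (x ∷ w ∷ a ∷ b ∷ y ∷ [] ,
            (x∈ , cong₂ _∷_ xw (cong₂ _∷_ (adj-sym ax) (cong₂ _∷_ (adj-sym bx) (cong (_∷ []) xy))) ,
             w∈ , cong₂ _∷_ (adj-sym aw) (cong₂ _∷_ wb (cong (_∷ []) wy)) ,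
             a∈ , cong₂ _∷_ ab (cong (_∷ []) ay) ,
             b∈ , cong (_∷ []) by , y∈ , refl , tt))
          where
            wb : adj w b ≡ false
            wb = ≢true⇒false λ t → ¬K (clique₃ a∈ w∈ b∈ aw ab t)
            wy : adj w y ≡ false
            wy = ≢true⇒false λ t → ¬K (clique₃ x∈ w∈ y∈ xw xy t)
        rest-independent : Independent (R ∖ L)
        rest-independent x y x∈ y∈ xy with rest {x} x∈ | rest {y} y∈
        ... | x∈R , ax , inj₁ bx | y∈R , ay , inj₁ by = neighbours-independent ¬K b∈ x y (∧-intro x∈R bx) (∧-intro y∈R by) xy
        ... | x∈R , ax , inj₁ bx | y∈R , ay , inj₂ (by , m) = crossing y∈R x∈R ay ax by m bx (adj-sym xy)
        ... | x∈R , ax , inj₂ (bx , m) | y∈R , ay , inj₁ by = crossing x∈R y∈R ax ay bx m by xy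
        ... | x∈R , ax , inj₂ (bx , _) | y∈R , ay , inj₂ (by , _) = far-far x∈R y∈R ax bx ay by xy

    Conf-extend : ∀ {S u v} → u ∈ₛ S → v ∈ₛ S → adj u v ≡ true → ∀ {k} (s : Shape k) xs → Conf (S ∩ far u v) s xs →
      Conf S s xs × Vec.map (adj u) xs ≡ Vec.replicate k false × Vec.map (adj v) xs ≡ Vec.replicate k false
    Conf-extend u∈ v∈ uv ∅ [] c = tt , refl , refl
    Conf-extend {S} {u} {v} u∈ v∈ uv (r ▹ s) (x ∷ xs) (x∈ , e , c) =
      let c′ , eu , ev = Conf-extend {S} u∈ v∈ uv s xs c
          x∈S , f = ∧-elim {S x} x∈
          ux , vx = ∧-elim {not (adj u x)} f in
      (x∈S , e , c′) , cong₂ _∷_ (not-elim ux) eu , cong₂ _∷_ (not-elim vx) ev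

  module TriangleFreeCritical (S : Sub) (¬K : ¬ Clique 3 S) (¬M : ¬ Matching 3 S) (nd : Configurations.NoDomination S) where
    open Configurations S
    open Proofs 2 2 ¬K ¬M
    open Excluding S 2 2 ¬K ¬M

    pentagonEdge-solved : Solved (Colourable S 4) (_ , pentagonEdge)
    pentagonEdge-solved xs conf = [ (λ c → c) , (λ av → PentagonEdge.colouring S ¬K ¬M av xs conf) ]′
      (avoid {Γ = pentagonEdgeLemmas} (All.head (derivable nd pentagonEdgeSteps-checked []) ∷ []))

    colouring : Colourable S 4
    colouring with edge-or-independent S
    ... | inj₂ ind = Colourable-mono (s≤s z≤n) (Colourable-independent ind)
    ... | inj₁ (u , v , u∈ , v∈ , uv) with conf? pentagonEdge
    ...   | yes (xs , c) = pentagonEdge-solved xs c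
    -- A pentagon far from `uv` would complete `pentagonEdge`, so the far set is bipartite and 2 + 2
    -- colours suffice.
    ...   | no ¬c = Colourable-around-edge ¬K u∈ v∈
              (bipartite (¬K ∘ Clique-mono {S = S ∩ far u v} {S} (∩-⊆ {S} {far u v})) (matching-far ¬M u∈ v∈ uv)
                λ (xs , c) → let c′ , eu , ev = Conf-extend {S} u∈ v∈ uv _ xs c in
                  ¬c (v ∷ u ∷ xs , v∈ , cong₂ _∷_ (adj-sym uv) ev , u∈ , eu , c′))

  triangle-free-3K₂-free : ∀ S → ¬ Clique 3 S × ¬ Matching 3 S → Colourable S 4
  triangle-free-3K₂-free = minimal-counterexample (λ S → ¬ Clique 3 S × ¬ Matching 3 S)
    (λ {S} {S′} sub (¬K , ¬M) → ¬K ∘ Clique-mono {S = S′} {S} sub , ¬M ∘ Matching-mono 3 {S′} {S} sub)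
    (λ S (¬K , ¬M) nd → TriangleFreeCritical.colouring S ¬K ¬M nd)

  -- HVN-free sets around a largest clique on at least four vertices

  Colourable-disjoint : ∀ {S k} (P : V → Bool) → Colourable (S ∩ P) k → Colourable (S ∖ P) k →
    (∀ u v → u ∈ₛ S ∩ P → v ∈ₛ S ∖ P → adj u v ≡ true → ⊥) → Colourable S k
  Colourable-disjoint {S} {k} P (c , c< , pc) (d , d< , pd) apart = e , e< , pe
    where
      e : V → ℕ
      e v = if P v then c v else d v
      e< : ∀ v → v ∈ₛ S → e v < k
      e< v v∈ with P v in eq
      ... | true  = c< v (∧-intro v∈ eq)
      ... | false = d< v (∧-intro v∈ (not-intro eq))
      pe : ∀ u v → u ∈ₛ S → v ∈ₛ S → adj u v ≡ true → e u ≢ e v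
      pe u v u∈ v∈ uv with P u in equ | P v in eqv
      ... | true  | true  = pc u v (∧-intro u∈ equ) (∧-intro v∈ eqv) uv
      ... | true  | false = ⊥-elim (apart u v (∧-intro u∈ equ) (∧-intro v∈ (not-intro eqv)) uv)
      ... | false | true  = ⊥-elim (apart v u (∧-intro v∈ eqv) (∧-intro u∈ (not-intro equ)) (adj-sym uv))
      ... | false | false = pd u v (∧-intro u∈ (not-intro equ)) (∧-intro v∈ (not-intro eqv)) uv

  ∩-elim : ∀ S P {v} → v ∈ₛ S ∩ P → v ∈ₛ S × P v ≡ true
  ∩-elim S P = ∧-elim

  ∖-elim : ∀ S P {v} → v ∈ₛ S ∖ P → v ∈ₛ S × P v ≡ false
  ∖-elim S P {v} v∈ = let a , b = ∧-elim {S v} v∈ in a , not-elim b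

  far-intro : ∀ S {u v w} → w ∈ₛ S → adj u w ≡ false → adj v w ≡ false → w ∈ₛ S ∩ far u v
  far-intro S w∈ uw vw = ∧-intro w∈ (∧-intro (not-intro uw) (not-intro vw))

  HVN-avoiding : Set
  HVN-avoiding = ∀ {a b c d x} → adj a b ≡ true → adj a c ≡ true → adj a d ≡ true → adj b c ≡ true →
    adj b d ≡ true → adj c d ≡ true → adj a x ≡ true → adj b x ≡ true → adj c x ≡ false → adj d x ≡ false → ⊥

  module LargeClique (noHVN : HVN-avoiding) {S : Sub} {s : ℕ} (φ : Fin (4 + s) → V) (φ∈ : ∀ i → φ i ∈ₛ S)
    (φ~ : ∀ i j → i ≢ j → adj (φ i) (φ j) ≡ true) (¬K : ¬ Clique (5 + s) S) where

    nb : Fin (4 + s) → V → Bool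
    nb i x = adj (φ i) x

    nb-≢ : ∀ {i j x} → nb i x ≡ true → nb j x ≡ false → i ≢ j
    nb-≢ a b refl = true≢false a b

    no-extension : (ψ : Fin (4 + s) → V) → (∀ i → ψ i ∈ₛ S) → (∀ i j → i ≢ j → adj (ψ i) (ψ j) ≡ true) →
      ∀ {x} → x ∈ₛ S → (∀ i → adj x (ψ i) ≡ true) → ⊥
    no-extension ψ ψ∈ ψ~ {x} x∈ x~ = ¬K (Clique-cons {S = S} {S ∩ adj x} x x∈ (λ z → z)
      (ψ , (λ i → ∧-intro (ψ∈ i) (x~ i)) , ψ~))

    -- The four clique vertices form the K₄ of an HVN, with `x` as the fifth vertex.
    two-two : ∀ {i j k l x} → i ≢ j → nb i x ≡ true → nb j x ≡ true → k ≢ l → nb k x ≡ false → nb l x ≡ false → ⊥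
    two-two i≢j xi xj k≢l xk xl = noHVN (φ~ _ _ i≢j) (φ~ _ _ (nb-≢ xi xk)) (φ~ _ _ (nb-≢ xi xl))
      (φ~ _ _ (nb-≢ xj xk)) (φ~ _ _ (nb-≢ xj xl)) (φ~ _ _ k≢l) xi xj xk xl

    -- The clique vertex `φ j` is itself of this kind.
    Full : Fin (4 + s) → V → Set
    Full j x = nb j x ≡ false × (∀ k → k ≢ j → nb k x ≡ true)

    full : ∀ {i k j x} → i ≢ k → nb i x ≡ true → nb k x ≡ true → nb j x ≡ false → Full j x
    full i≢k xi xk xj = xj , λ l l≢j → [ (λ t → t) , (λ f → ⊥-elim (two-two i≢k xi xk l≢j f xj)) ]′ (bool-dec _)

    missing : ∀ {x} → x ∈ₛ S → Σ (Fin (4 + s)) λ j → nb j x ≡ false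
    missing {x} x∈ with findᵇ (λ j → not (nb j x))
    ... | inj₁ (j , e) = j , not-elim e
    ... | inj₂ f = ⊥-elim (no-extension φ φ∈ φ~ x∈ (λ i → adj-sym (not-false (f i))))

    -- With `x` in place of `φ j` the clique keeps its size, and `y` would extend it.
    same-full : ∀ {j x y} → x ∈ₛ S → y ∈ₛ S → Full j x → Full j y → adj x y ≡ true → ⊥
    same-full {j} {x} {y} x∈ y∈ (_ , fx) (_ , fy) xy = no-extension ψ ψ∈ ψ~ y∈ y~
      where
        ψ : Fin (4 + s) → V
        ψ i = if ⌊ i ≟ᶠ j ⌋ then x else φ i
        ψ∈ : ∀ i → ψ i ∈ₛ S
        ψ∈ i with ⌊ i ≟ᶠ j ⌋
        ... | true  = x∈
        ... | false = φ∈ i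
        ψ~ : ∀ i k → i ≢ k → adj (ψ i) (ψ k) ≡ true
        ψ~ i k i≢k with ⌊ i ≟ᶠ j ⌋ in ei | ⌊ k ≟ᶠ j ⌋ in ek
        ... | true  | true  = ⊥-elim (i≢k (trans (⌊⌋-elim ei) (sym (⌊⌋-elim ek))))
        ... | true  | false = adj-sym (fx k (⌊⌋-false ek))
        ... | false | true  = fx i (⌊⌋-false ei)
        ... | false | false = φ~ i k i≢k
        y~ : ∀ i → adj y (ψ i) ≡ true
        y~ i with ⌊ i ≟ᶠ j ⌋ in ei
        ... | true  = adj-sym xy
        ... | false = adj-sym (fy i (⌊⌋-false ei))

    outside : ∀ j k → Σ (Fin (4 + s)) λ a → Σ (Fin (4 + s)) λ b → a ≢ b × a ≢ j × b ≢ j × a ≢ k × b ≢ k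
    outside j k with two-outside (λ i → ⌊ i ≟ᶠ j ⌋) (λ i → ⌊ i ≟ᶠ k ⌋) (equals-AtMostOne j) (equals-AtMostOne k)
    ... | a , b , a≢b , aj , bj , ak , bk = a , b , a≢b , ⌊⌋-false aj , ⌊⌋-false bj , ⌊⌋-false ak , ⌊⌋-false bk

    -- Otherwise `y` sees exactly `φ a` and `φ b` of the K₄ formed by `φ a`, `φ b`, `x` and `φ k`.
    different-full : ∀ {j k x y} → j ≢ k → Full j x → Full k y → adj x y ≡ true
    different-full {j} {k} {x} {y} j≢k (_ , fx) (yk , fy) with bool-dec (adj x y)
    ... | inj₁ t = t
    ... | inj₂ f with outside j k
    ...   | a , b , a≢b , aj , bj , ak , bk =
      ⊥-elim (noHVN (φ~ a b a≢b) (fx a aj) (φ~ a k ak) (fx b bj) (φ~ b k bk) (adj-sym (fx k (j≢k ∘ sym)))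
        (fy a ak) (fy b bk) f yk)

    -- Otherwise `x` sees exactly `φ i` and `y` of the K₄ formed by `φ i`, `y`, `φ c` and `φ d`.
    single-full : ∀ {i a b j x y} → nb i x ≡ true → a ≢ b → nb a x ≡ false → nb b x ≡ false →
      i ≢ j → Full j y → adj x y ≡ true → ⊥
    single-full {i} {a} {b} {j} {x} {y} xi a≢b xa xb i≢j (_ , fy) xy with outside i j
    ... | c , d , c≢d , ci , di , cj , dj =
      noHVN (fy i i≢j) (φ~ i c (ci ∘ sym)) (φ~ i d (di ∘ sym)) (adj-sym (fy c cj)) (adj-sym (fy d dj)) (φ~ c d c≢d)
        xi (adj-sym xy) (only c ci) (only d di)
      where
        only : ∀ c → c ≢ i → nb c x ≡ false
        only c c≢i = ≢true⇒false λ xc → two-two c≢i xc xi a≢b xa xb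

    two : V → Bool
    two x = exists (λ i → exists (λ j → not ⌊ i ≟ᶠ j ⌋ ∧ (nb i x ∧ nb j x)))

    two-full : ∀ {x j} → two x ≡ true → nb j x ≡ false → Full j x
    two-full {x} t xj =
      let i , e = exists-elim _ t
          k , e′ = exists-elim _ e
          i≢k , e″ = ∧-elim {not ⌊ i ≟ᶠ k ⌋} e′
          xi , xk = ∧-elim {nb i x} e″ in
      full (⌊⌋-false (not-elim i≢k)) xi xk xj

    ¬two : ∀ {x} → two x ≡ false → AtMostOne (λ i → nb i x)
    ¬two {x} f i j i≢j xi xj = true≢false
      (exists-intro _ i (exists-intro _ j (∧-intro (not-intro (⌊⌋-≢ i≢j)) (∧-intro xi xj)))) f

    full? : Fin (4 + s) → V → Bool
    full? j y = S y ∧ (two y ∧ not (nb j y))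

    full?-elim : ∀ j y → full? j y ≡ true → y ∈ₛ S × Full j y
    full?-elim j y e =
      let y∈ , e′ = ∧-elim {S y} e
          t , yj = ∧-elim {two y} e′ in
      y∈ , two-full t (not-elim yj)

    -- If `x` had a neighbour of each kind `j`, these neighbours would be pairwise adjacent by
    -- `different-full`, and `x` would extend their clique.
    choice : ∀ {x} → x ∈ₛ S → Σ (Fin (4 + s)) λ j → exists (λ y → full? j y ∧ adj x y) ≡ false
    choice {x} x∈ with findᵇ (λ j → not (exists (λ y → full? j y ∧ adj x y)))
    ... | inj₁ (j , e) = j , not-elim e
    ... | inj₂ f = ⊥-elim (no-extension ψ (λ j → proj₁ (full?-elim j (ψ j) (ψ-full j))) ψ~ x∈ (λ j → proj₂ (∧-elim {full? j (ψ j)} (proj₂ (found j)))))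
      where
        found : ∀ j → Σ V λ y → full? j y ∧ adj x y ≡ true
        found j with bool-dec (exists (λ y → full? j y ∧ adj x y))
        ... | inj₁ t = exists-elim _ t
        ... | inj₂ e = ⊥-elim (true≢false (not-intro e) (f j))
        ψ : Fin (4 + s) → V
        ψ j = proj₁ (found j)
        ψ-full : ∀ j → full? j (ψ j) ≡ true
        ψ-full j = proj₁ (∧-elim {full? j (ψ j)} (proj₂ (found j)))
        ψ~ : ∀ i j → i ≢ j → adj (ψ i) (ψ j) ≡ true
        ψ~ i j i≢j = different-full i≢j (proj₂ (full?-elim i (ψ i) (ψ-full i))) (proj₂ (full?-elim j (ψ j) (ψ-full j)))

    -- A vertex that misses only `φ j` gets colour `j`; any other vertex gets a colour from
    -- `choice`.
    colouring₂ : ¬ Matching 2 S → Colourable S (4 + s)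
    colouring₂ ¬M = c , c< , proper
      where
        -- The equation supplies the membership proof; outside `S` the value is arbitrary.
        index : ∀ x b → S x ≡ b → Fin (4 + s)
        index x true  x∈ = if two x then proj₁ (missing x∈) else proj₁ (choice x∈)
        index x false _  = zero
        c : V → ℕ
        c x = toℕ (index x (S x) refl)
        c< : ∀ x → x ∈ₛ S → c x < 4 + s
        c< x _ = toℕ<n (index x (S x) refl)
        Class : Fin (4 + s) → V → Set
        Class j x = Full j x ⊎ (AtMostOne (λ i → nb i x) × exists (λ y → full? j y ∧ adj x y) ≡ false)
        classify : ∀ x b (e : S x ≡ b) → x ∈ₛ S → Class (index x b e) x × (Full (index x b e) x → two x ≡ true)
        classify x true e x∈ with bool-dec (two x)
        ... | inj₁ t rewrite t = inj₁ (two-full t (proj₂ (missing e))) , λ _ → refl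
        ... | inj₂ f rewrite f = inj₂ (¬two f , proj₂ (choice e)) ,
              λ (_ , fx) → ⊥-elim (spread fx)
          where
            spread : ∀ {j} → (∀ k → k ≢ j → nb k x ≡ true) → ⊥
            spread {j} fx with outside j j
            ... | a , b , a≢b , aj , bj , _ = ¬two f a b a≢b (fx a aj) (fx b bj)
        classify x false e x∈ = ⊥-elim (true≢false x∈ e)
        mixed : ∀ {x y j} → y ∈ₛ S → two y ≡ true → Full j y → exists (λ y → full? j y ∧ adj x y) ≡ false → adj x y ≡ true → ⊥
        mixed {x} {y} y∈ t (yj , _) none xy =
          true≢false (∧-intro (∧-intro y∈ (∧-intro t (not-intro yj))) xy) (not-exists _ none y)
        proper : ∀ x y → x ∈ₛ S → y ∈ₛ S → adj x y ≡ true → c x ≢ c y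
        proper x y x∈ y∈ xy eq = go (proj₁ cx) (proj₁ cy)
          where
            cx = classify x (S x) refl x∈
            cy = classify y (S y) refl y∈
            same : index x (S x) refl ≡ index y (S y) refl
            same = toℕ-injective eq
            go : Class (index x (S x) refl) x → Class (index y (S y) refl) y → ⊥
            go (inj₁ a) (inj₁ b) = same-full x∈ y∈ a (subst (λ j → Full j y) (sym same) b) xy
            go (inj₁ a) (inj₂ (_ , b)) = mixed x∈ (proj₂ cx a) (subst (λ j → Full j x) same a) b (adj-sym xy)
            go (inj₂ (_ , a)) (inj₁ b) = mixed y∈ (proj₂ cy b) (subst (λ j → Full j y) (sym same) b) a xy
            go (inj₂ (ax , _)) (inj₂ (ay , _)) with two-outside (λ i → nb i x) (λ i → nb i y) ax ay
            -- Both vertices have at most one neighbour in the clique, so some clique edge is far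
            -- from both and forms a 2K₂ with `xy`.
            ... | a , b , a≢b , xa , xb , ya , yb =
              far-independent ¬M (φ∈ a) (φ∈ b) (φ~ a b a≢b) x y (far-intro S x∈ xa xb) (far-intro S y∈ ya yb) xy

    private
      0F 1F 2F : Fin (4 + s)
      0F = zero
      1F = suc zero
      2F = suc (suc zero)

    Single : Fin (4 + s) → V → Set
    Single i x = nb i x ≡ true × Σ (Fin (4 + s)) λ a → Σ (Fin (4 + s)) λ b → a ≢ b × nb a x ≡ false × nb b x ≡ false

    single-apart : ∀ {i j x y} → i ≢ j → Single i x → Full j y → adj x y ≡ true → ⊥
    single-apart i≢j (xi , a , b , a≢b , xa , xb) fy xy = single-full xi a≢b xa xb i≢j fy xy

    -- Saves a colour by identifying 0 with `1F`. The latter never occurs, since the vertices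
    -- coloured this way are adjacent to `φ 1F`.
    squash : Fin (4 + s) → ℕ
    squash zero    = 0
    squash (suc j) = toℕ j

    squash-< : ∀ j → squash j < 3 + s
    squash-< zero    = s≤s z≤n
    squash-< (suc j) = toℕ<n j

    squash-injective : ∀ j k → j ≢ 1F → k ≢ 1F → squash j ≡ squash k → j ≡ k
    squash-injective zero    zero          _  _  _ = refl
    squash-injective zero    (suc zero)    _  k≢ _ = ⊥-elim (k≢ refl)
    squash-injective (suc zero)    zero    j≢ _  _ = ⊥-elim (j≢ refl)
    squash-injective (suc j) (suc k)       _  _  e = cong suc (toℕ-injective e)

    -- Each of these sees `φ 1F` and one of `φ 0F`, `φ 2F`; two neighbours in the clique leave
    -- exactly one missing.
    Pairs : Sub
    Pairs = S ∩ nb 1F ∖ (λ x → not (nb 0F x) ∧ not (nb 2F x))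

    Pairs-full : ∀ {x} → x ∈ₛ Pairs → x ∈ₛ S × Σ (Fin (4 + s)) λ j → Full j x × j ≢ 1F
    Pairs-full {x} x∈ with ∖-elim (S ∩ nb 1F) (λ x → not (nb 0F x) ∧ not (nb 2F x)) x∈
    ... | x∈₁ , e with ∩-elim S (nb 1F) x∈₁
    ...   | x∈S , x₁ with missing x∈S
    ...     | j , xj = x∈S , j , fullness , λ { refl → true≢false x₁ xj }
      where
        fullness : Full j x
        fullness with bool-dec (nb 0F x) | bool-dec (nb 2F x)
        ... | inj₁ x₀ | _       = full {0F} {1F} (λ ()) x₀ x₁ xj
        ... | inj₂ _  | inj₁ x₂ = full {2F} {1F} (λ ()) x₂ x₁ xj
        ... | inj₂ x₀ | inj₂ x₂ = ⊥-elim (true≢false (∧-intro (not-intro x₀) (not-intro x₂)) e)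

    Pairs-colourable : Colourable Pairs (3 + s)
    Pairs-colourable = c , c< , proper
      where
        index : ∀ x b → Pairs x ≡ b → Fin (4 + s)
        index x true  x∈ = proj₁ (proj₂ (Pairs-full {x} x∈))
        index x false _  = zero
        c : V → ℕ
        c x = squash (index x (Pairs x) refl)
        c< : ∀ x → x ∈ₛ Pairs → c x < 3 + s
        c< x _ = squash-< (index x (Pairs x) refl)
        index-full : ∀ x b (e : Pairs x ≡ b) → x ∈ₛ Pairs → Full (index x b e) x × index x b e ≢ 1F
        index-full x true  e _  = proj₂ (proj₂ (Pairs-full {x} e))
        index-full x false e x∈ = ⊥-elim (true≢false x∈ e)
        proper : ∀ x y → x ∈ₛ Pairs → y ∈ₛ Pairs → adj x y ≡ true → c x ≢ c y
        proper x y x∈ y∈ xy eq with index-full x (Pairs x) refl x∈ | index-full y (Pairs y) refl y∈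
        ... | fx , x≢ | fy , y≢ = same-full (proj₁ (Pairs-full {x} x∈)) (proj₁ (Pairs-full {y} y∈)) fx
              (subst (λ j → Full j y) (sym (squash-injective _ _ x≢ y≢ eq)) fy) xy

    -- A vertex with a single neighbour φ i in the clique is not adjacent to a vertex that misses some φ j with
    -- j ≢ i only, so that the two kinds may share their colours.
    colouring₊ : ∀ {k l} → 3 + s ≤ k → Colourable (S ∩ far (φ 0F) (φ 1F)) l →
      Colourable (S ∩ nb 1F ∩ far (φ 0F) (φ 2F)) k → Colourable (S ∩ nb 0F ∩ far (φ 1F) (φ 2F)) k →
      Colourable S (k + (k + l))
    colouring₊ {k} {l} 3+s≤k C C₁ C₀ =
      Colourable-split (nb 1F) near₁ (Colourable-split (nb 0F) near₀ (Colourable-⊆ rest C))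
      where
        single₁ : V → Bool
        single₁ x = not (nb 0F x) ∧ not (nb 2F x)
        near₁ : Colourable (S ∩ nb 1F) k
        near₁ = Colourable-disjoint single₁ C₁ (Colourable-mono 3+s≤k Pairs-colourable) apart
          where
            apart : ∀ x y → x ∈ₛ S ∩ nb 1F ∩ single₁ → y ∈ₛ S ∩ nb 1F ∖ single₁ → adj x y ≡ true → ⊥
            apart x y x∈ y∈ xy with ∩-elim (S ∩ nb 1F) single₁ x∈
            ... | x∈₁ , e with ∧-elim {not (nb 0F x)} e | Pairs-full {y} y∈
            ...   | x₀ , x₂ | _ , j , fy , j≢1 = single-apart (j≢1 ∘ sym)
                    (proj₂ (∩-elim S (nb 1F) x∈₁) , 0F , 2F , (λ ()) , not-elim x₀ , not-elim x₂) fy xy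
        near₀ : Colourable (S ∖ nb 1F ∩ nb 0F) k
        near₀ = Colourable-disjoint (not ∘ nb 2F) (Colourable-⊆ shrink C₀)
            -- Vertices that see `φ 0F` and `φ 2F` but not `φ 1F` all miss the same clique vertex,
            -- so one colour is enough.
            (Colourable-mono (≤-trans (s≤s z≤n) 3+s≤k) (Colourable-independent pairs-independent)) apart
          where
            Q : Sub
            Q = S ∖ nb 1F ∩ nb 0F
            parts : ∀ {x} → x ∈ₛ Q → x ∈ₛ S × nb 1F x ≡ false × nb 0F x ≡ true
            parts x∈ with ∩-elim (S ∖ nb 1F) (nb 0F) x∈
            ... | x∈′ , x₀ with ∖-elim S (nb 1F) x∈′
            ...   | x∈S , x₁ = x∈S , x₁ , x₀
            shrink : Q ∩ (not ∘ nb 2F) ⊆ₛ S ∩ nb 0F ∩ far (φ 1F) (φ 2F)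
            shrink {x} x∈ with ∩-elim Q (not ∘ nb 2F) x∈
            ... | x∈Q , x₂ with parts {x} x∈Q
            ...   | x∈S , x₁ , x₀ = far-intro (S ∩ nb 0F) (∧-intro x∈S x₀) x₁ (not-elim x₂)
            fullness : ∀ {x} → x ∈ₛ Q ∖ (not ∘ nb 2F) → x ∈ₛ S × Full 1F x
            fullness {x} x∈ with ∖-elim Q (not ∘ nb 2F) x∈
            ... | x∈Q , x₂ with parts {x} x∈Q
            ...   | x∈S , x₁ , x₀ = x∈S , full {0F} {2F} (λ ()) x₀ (not-false x₂) x₁
            pairs-independent : Independent (Q ∖ (not ∘ nb 2F))
            pairs-independent x y x∈ y∈ xy with fullness {x} x∈ | fullness {y} y∈
            ... | x∈S , fx | y∈S , fy = same-full x∈S y∈S fx fy xy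
            apart : ∀ x y → x ∈ₛ Q ∩ (not ∘ nb 2F) → y ∈ₛ Q ∖ (not ∘ nb 2F) → adj x y ≡ true → ⊥
            apart x y x∈ y∈ xy with ∩-elim Q (not ∘ nb 2F) x∈
            ... | x∈Q , x₂ with parts {x} x∈Q
            ...   | _ , x₁ , x₀ = single-apart {0F} {1F} (λ ()) (x₀ , 1F , 2F , (λ ()) , x₁ , not-elim x₂)
                    (proj₂ (fullness {y} y∈)) xy
        rest : S ∖ nb 1F ∖ nb 0F ⊆ₛ S ∩ far (φ 0F) (φ 1F)
        rest {x} x∈ with ∖-elim (S ∖ nb 1F) (nb 0F) x∈
        ... | x∈′ , x₀ with ∖-elim S (nb 1F) x∈′
        ...   | x∈S , x₁ = far-intro S x∈S x₀ x₁

  -- The induction on p and the clique number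

  clique-below : ∀ {m S u} → ¬ Clique (suc m) S → u ∈ₛ S → ¬ Clique m (S ∩ adj u)
  clique-below {S = S} {u} ¬K u∈ K = ¬K (Clique-cons {S = S} {S ∩ adj u} u u∈ (λ z → z) K)

  clique-⊆ : ∀ {m S S′} → S′ ⊆ₛ S → ¬ Clique m S → ¬ Clique m S′
  clique-⊆ {S = S} {S′} sub ¬K = ¬K ∘ Clique-mono {S = S′} {S} sub

  matching-⊆ : ∀ p {S S′} → S′ ⊆ₛ S → ¬ Matching p S → ¬ Matching p S′
  matching-⊆ p {S} {S′} sub ¬M = ¬M ∘ Matching-mono p {S′} {S} sub

  far-∩-⊆ : ∀ S P u v → S ∩ P ∩ far u v ⊆ₛ S ∩ far u v
  far-∩-⊆ S P u v {x} x∈ with ∩-elim (S ∩ P) (far u v) x∈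
  ... | x∈′ , e = ∧-intro (proj₁ (∩-elim S P x∈′)) e

  module _ {S : Sub} (¬K : ¬ Clique 4 S) {a b c : V} (a∈ : a ∈ₛ S) (b∈ : b ∈ₛ S) (c∈ : c ∈ₛ S)
    (ab : adj a b ≡ true) (ac : adj a c ≡ true) (bc : adj b c ≡ true) where

    common-independent : ∀ {T u v} → u ∈ₛ S → v ∈ₛ S → adj u v ≡ true →
      (∀ {x} → x ∈ₛ T → x ∈ₛ S × adj u x ≡ true × adj v x ≡ true) → Independent T
    common-independent u∈ v∈ uv sub x y x∈ y∈ xy =
      let x∈S , ux , vx = sub {x} x∈
          y∈S , uy , vy = sub {y} y∈ in
      ¬K (clique₄ u∈ v∈ x∈S y∈S uv ux uy vx vy xy)

    colouring-around-triangle : ∀ {k l} → Colourable (S ∩ far a b) l →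
      Colourable (S ∩ adj a ∩ far b c) k → Colourable (S ∩ adj b ∩ far a c) k →
      Colourable S ((1 + (1 + k)) + ((1 + k) + l))
    -- Each of the three ones pays for the common neighbours of a pair, which are independent as
    -- there is no K₄. The private neighbours of `a` and of `b` take `k` each; those of `c` belong
    -- to the set far from `a` and `b`.
    colouring-around-triangle C Ca Cb =
      Colourable-split (adj a)
        (Colourable-split (adj b)
          (Colourable-independent (common-independent a∈ b∈ ab λ x∈ →
            let x∈′ , bx = ∩-elim (S ∩ adj a) (adj b) x∈
                x∈S , ax = ∩-elim S (adj a) x∈′ in x∈S , ax , bx))
          (Colourable-split (adj c)
            (Colourable-independent (common-independent a∈ c∈ ac λ x∈ →
              let x∈″ , cx = ∩-elim (S ∩ adj a ∖ adj b) (adj c) x∈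
                  x∈′ , _  = ∖-elim (S ∩ adj a) (adj b) x∈″
                  x∈S , ax = ∩-elim S (adj a) x∈′ in x∈S , ax , cx))
            (Colourable-⊆ (λ x∈ →
              let x∈″ , cx = ∖-elim (S ∩ adj a ∖ adj b) (adj c) x∈
                  x∈′ , bx = ∖-elim (S ∩ adj a) (adj b) x∈″ in far-intro (S ∩ adj a) x∈′ bx cx) Ca)))
        (Colourable-split (adj b)
          (Colourable-split (adj c)
            (Colourable-independent (common-independent b∈ c∈ bc λ x∈ →
              let x∈″ , cx = ∩-elim (S ∖ adj a ∩ adj b) (adj c) x∈
                  x∈′ , bx = ∩-elim (S ∖ adj a) (adj b) x∈″
                  x∈S , _  = ∖-elim S (adj a) x∈′ in x∈S , bx , cx))
            (Colourable-⊆ (λ x∈ →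
              let x∈″ , cx = ∖-elim (S ∖ adj a ∩ adj b) (adj c) x∈
                  x∈′ , bx = ∩-elim (S ∖ adj a) (adj b) x∈″
                  x∈S , ax = ∖-elim S (adj a) x∈′ in far-intro (S ∩ adj b) (∧-intro x∈S bx) ax cx) Cb))
          (Colourable-⊆ (λ x∈ →
            let x∈′ , bx = ∖-elim (S ∖ adj a) (adj b) x∈
                x∈S , ax = ∖-elim S (adj a) x∈′ in far-intro S x∈S ax bx) C))

  Bounded : ℕ → ℕ → Set
  Bounded p m = ∀ S → ¬ Clique (suc m) S → ¬ Matching (2 + p) S → Colourable S (g p m)

  edgeless : ∀ p → Bounded p 0
  edgeless p S ¬K ¬M = (λ _ → 0) , (λ v v∈ → ⊥-elim (empty v v∈)) , λ u _ u∈ _ _ _ → empty u u∈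
    where
      empty : ∀ v → v ∈ₛ S → ⊥
      empty v v∈ = ¬K ((λ _ → v) , (λ _ → v∈) , λ where zero zero ne → ⊥-elim (ne refl))

  far-bounded : ∀ {p m S u v} → Bounded p m → ¬ Clique (suc m) S → ¬ Matching (3 + p) S →
    u ∈ₛ S → v ∈ₛ S → adj u v ≡ true → Colourable (S ∩ far u v) (g p m)
  far-bounded {S = S} {u} {v} B ¬K ¬M u∈ v∈ uv =
    B (S ∩ far u v) (clique-⊆ {S = S} (∩-⊆ {S} {far u v}) ¬K) (matching-far ¬M u∈ v∈ uv)

  -- Adjacency to `w` lowers the clique number and distance from `uv` lowers p, so both arguments
  -- drop at once.
  near-far-bounded : ∀ {p m S w u v} → Bounded p m → ¬ Clique (2 + m) S → ¬ Matching (3 + p) S →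
    w ∈ₛ S → u ∈ₛ S → v ∈ₛ S → adj u v ≡ true → Colourable (S ∩ adj w ∩ far u v) (g p m)
  near-far-bounded {p} {S = S} {w} {u} {v} B ¬K ¬M w∈ u∈ v∈ uv = B (S ∩ adj w ∩ far u v)
    (clique-⊆ {S = S ∩ adj w} (∩-⊆ {S ∩ adj w} {far u v}) (clique-below {S = S} ¬K w∈))
    (matching-⊆ (2 + p) {S ∩ far u v} (far-∩-⊆ S (adj w) u v) (matching-far ¬M u∈ v∈ uv))

  step₂ : ∀ {p} → Bounded (suc p) 2 → Bounded (2 + p) 2
  step₂ B S ¬K ¬M with edge-or-independent S
  ... | inj₂ ind = Colourable-mono (s≤s z≤n) (Colourable-independent ind)
  ... | inj₁ (u , v , u∈ , v∈ , uv) = Colourable-around-edge ¬K u∈ v∈ (far-bounded B ¬K ¬M u∈ v∈ uv)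

  -- The neighbourhoods of `u` and `v` contain neither K₃ nor 3K₂, the far set neither K₄ nor 2K₂:
  -- four colours for each of the three.
  base₃ : Bounded 0 3 → Bounded 1 2 → Bounded 1 3
  base₃ B B′ S ¬K ¬M with edge-or-independent S
  ... | inj₂ ind = Colourable-mono (s≤s z≤n) (Colourable-independent ind)
  ... | inj₁ (u , v , u∈ , v∈ , uv) =
        Colourable-split (adj u) (near u u∈)
          (Colourable-split (adj v)
            (Colourable-⊆ (λ x∈ →
              let x∈′ , vx = ∩-elim (S ∖ adj u) (adj v) x∈ in
              ∧-intro (proj₁ (∖-elim S (adj u) x∈′)) vx) (near v v∈))
            (Colourable-⊆ (λ x∈ →
              let x∈′ , vx = ∖-elim (S ∖ adj u) (adj v) x∈
                  x∈S , ux = ∖-elim S (adj u) x∈′ in far-intro S x∈S ux vx)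
              (far-bounded B ¬K ¬M u∈ v∈ uv)))
    where
      near : ∀ w → w ∈ₛ S → Colourable (S ∩ adj w) 4
      near w w∈ = B′ (S ∩ adj w) (clique-below {S = S} ¬K w∈) (matching-⊆ 3 {S} (∩-⊆ {S} {adj w}) ¬M)

  step₃ : ∀ {p} → Bounded (suc p) 2 → Bounded (suc p) 3 → Bounded (2 + p) 2 → Bounded (2 + p) 3
  step₃ {p} B₂ B₃ B₂′ S ¬K ¬M with clique? 3 S
  ... | no ¬K₃ = Colourable-mono (g-mono (suc (suc p)) 2) (B₂′ S ¬K₃ ¬M)
  ... | yes (φ , φ∈ , φ~) = Colourable-mono (≤-reflexive (total (g₂ (suc p)) (g₃ (suc p))))
        (colouring-around-triangle ¬K (φ∈ 0F) (φ∈ 1F) (φ∈ 2F) (φ~ 0F 1F λ ()) (φ~ 0F 2F λ ()) (φ~ 1F 2F λ ())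
          (far-bounded B₃ ¬K ¬M (φ∈ 0F) (φ∈ 1F) (φ~ 0F 1F λ ()))
          (near-far-bounded B₂ ¬K ¬M (φ∈ 0F) (φ∈ 1F) (φ∈ 2F) (φ~ 1F 2F λ ()))
          (near-far-bounded B₂ ¬K ¬M (φ∈ 1F) (φ∈ 0F) (φ∈ 2F) (φ~ 0F 2F λ ())))
    where
      0F 1F 2F : Fin 3
      0F = zero
      1F = suc zero
      2F = suc (suc zero)
      total : ∀ k l → (1 + (1 + k)) + ((1 + k) + l) ≡ l + (2 * k + 3)
      total = solve-∀

  module _ (noHVN : HVN-avoiding) where

    base₄ : ∀ s → Bounded 0 (3 + s) → Bounded 0 (4 + s)
    base₄ s B S ¬K ¬M with clique? (4 + s) S
    ... | no ¬K′ = Colourable-mono (g-mono 0 (3 + s)) (B S ¬K′ ¬M)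
    ... | yes (φ , φ∈ , φ~) = LargeClique.colouring₂ noHVN {S} φ φ∈ φ~ ¬K ¬M

    step₄ : ∀ {p} s → Bounded p (3 + s) → Bounded p (4 + s) → Bounded (suc p) (3 + s) → Bounded (suc p) (4 + s)
    step₄ {p} s B B′ B″ S ¬K ¬M with clique? (4 + s) S
    ... | no ¬K′ = Colourable-mono (g-mono (suc p) (3 + s)) (B″ S ¬K′ ¬M)
    ... | yes (φ , φ∈ , φ~) = Colourable-mono (≤-reflexive (total (g p (3 + s)) (g p (4 + s))))
          (LargeClique.colouring₊ noHVN {S} φ φ∈ φ~ ¬K (m≤g p s)
            (far-bounded B′ ¬K ¬M (φ∈ 0F) (φ∈ 1F) (φ~ 0F 1F λ ()))
            (near-far-bounded B ¬K ¬M (φ∈ 1F) (φ∈ 0F) (φ∈ 2F) (φ~ 0F 2F λ ()))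
            (near-far-bounded B ¬K ¬M (φ∈ 0F) (φ∈ 1F) (φ∈ 2F) (φ~ 1F 2F λ ())))
      where
        0F 1F 2F : Fin (4 + s)
        0F = zero
        1F = suc zero
        2F = suc (suc zero)
        total : ∀ k l → k + (k + l) ≡ l + 2 * k
        total = solve-∀

    bound : ∀ p m → Bounded p m
    bound p 0 = edgeless p
    bound p 1 S ¬K ¬M = Colourable-independent λ u v u∈ v∈ uv → ¬K (clique₂ u∈ v∈ uv)
    bound 0 2 S ¬K ¬M = triangle-free-2K₂-free ¬K ¬M
    bound 1 2 S ¬K ¬M = triangle-free-3K₂-free S (¬K , ¬M)
    bound (suc (suc p)) 2 = step₂ (bound (suc p) 2)
    bound 0 3 S ¬K ¬M = K₄-free-2K₂-free S (¬K , ¬M)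
    bound 1 3 = base₃ (bound 0 3) (bound 1 2)
    bound (suc (suc p)) 3 = step₃ (bound (suc p) 2) (bound (suc p) 3) (bound (suc (suc p)) 2)
    bound 0       (suc m@(suc (suc (suc s)))) = base₄ s (bound 0 m)
    bound (suc p) (suc m@(suc (suc (suc s)))) = step₄ s (bound p m) (bound p (suc m)) (bound (suc p) m)

  -- Translation into induced subgraphs and proper colourings

  full-sub : Sub
  full-sub _ = true

  -- Vertices with the same image have the same neighbours in `H`, so it suffices that
  -- neighbourhoods separate vertices.
  preserving-injective : ∀ {W : Set} (H : Graph W) (φ : W → V) → (∀ u v → Adj H u v ≡ adj (φ u) (φ v)) →
    (∀ u v → u ≡ v ⊎ Σ W λ w → Adj H u w ≢ Adj H v w) → Injective _≡_ _≡_ φ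
  preserving-injective H φ hom sep {u} {v} e with sep u v
  ... | inj₁ u≡v = u≡v
  ... | inj₂ (w , ne) = ⊥-elim (ne (trans (hom u w) (trans (cong (λ z → adj z (φ w)) e) (sym (hom v w)))))

  HVN-free⇒avoiding : Free HVN G → HVN-avoiding
  HVN-free⇒avoiding free {a} {b} {c} {d} {x} ab ac ad bc bd cd ax bx cx dx =
    free (φ , preserving-injective HVN φ hom
      (from-yes (all? λ u → all? λ v → (u ≟ᶠ v) ⊎-dec any? λ w → ¬? (Adj HVN u w ≟ᵇ Adj HVN v w))) , hom)
    where
      φ : Fin 5 → V
      φ = lookup (a ∷ b ∷ c ∷ d ∷ x ∷ [])
      loop : ∀ v → false ≡ adj v v
      loop v = sym (proj₂ simple v)
      flip : ∀ {u v t} → adj u v ≡ t → t ≡ adj v u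
      flip e = sym (adj-sym e)
      hom : ∀ u v → Adj HVN u v ≡ adj (φ u) (φ v)
      hom zero zero = loop a
      hom zero (suc zero) = sym ab
      hom zero (suc (suc zero)) = sym ac
      hom zero (suc (suc (suc zero))) = sym ad
      hom zero (suc (suc (suc (suc zero)))) = sym ax
      hom (suc zero) zero = flip ab
      hom (suc zero) (suc zero) = loop b
      hom (suc zero) (suc (suc zero)) = sym bc
      hom (suc zero) (suc (suc (suc zero))) = sym bd
      hom (suc zero) (suc (suc (suc (suc zero)))) = sym bx
      hom (suc (suc zero)) zero = flip ac
      hom (suc (suc zero)) (suc zero) = flip bc
      hom (suc (suc zero)) (suc (suc zero)) = loop c
      hom (suc (suc zero)) (suc (suc (suc zero))) = sym cd
      hom (suc (suc zero)) (suc (suc (suc (suc zero)))) = sym cx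
      hom (suc (suc (suc zero))) zero = flip ad
      hom (suc (suc (suc zero))) (suc zero) = flip bd
      hom (suc (suc (suc zero))) (suc (suc zero)) = flip cd
      hom (suc (suc (suc zero))) (suc (suc (suc zero))) = loop d
      hom (suc (suc (suc zero))) (suc (suc (suc (suc zero)))) = sym dx
      hom (suc (suc (suc (suc zero)))) zero = flip ax
      hom (suc (suc (suc (suc zero)))) (suc zero) = flip bx
      hom (suc (suc (suc (suc zero)))) (suc (suc zero)) = flip cx
      hom (suc (suc (suc (suc zero)))) (suc (suc (suc zero))) = flip dx
      hom (suc (suc (suc (suc zero)))) (suc (suc (suc (suc zero)))) = loop x

  matching-embedding : ∀ p S → Matching p S → Σ (Fin p × Fin 2 → V) λ φ →
    (∀ w → φ w ∈ₛ S) × (∀ w z → Adj (pK₂ p) w z ≡ adj (φ w) (φ z))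
  matching-embedding zero    S _ = (λ ()) , (λ ()) , λ ()
  matching-embedding (suc p) S (u , v , u∈ , v∈ , uv , M) = φ , φ∈ , hom
    where
      rec = matching-embedding p (S ∩ far u v) M
      ψ = proj₁ rec
      φ : Fin (suc p) × Fin 2 → V
      φ (zero  , zero)     = u
      φ (zero  , suc zero) = v
      φ (suc i , a)        = ψ (i , a)
      φ∈ : ∀ w → φ w ∈ₛ S
      φ∈ (zero  , zero)     = u∈
      φ∈ (zero  , suc zero) = v∈
      φ∈ (suc i , a)        = ∩-⊆ {S} {far u v} (proj₁ (proj₂ rec) (i , a))
      apart : ∀ w → adj u (ψ w) ≡ false × adj v (ψ w) ≡ false
      apart w = let a , b = ∧-elim {not (adj u (ψ w))} (proj₂ (∩-elim S (far u v) (proj₁ (proj₂ rec) w))) in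
        not-elim a , not-elim b
      hom : ∀ w z → Adj (pK₂ (suc p)) w z ≡ adj (φ w) (φ z)
      hom (zero , zero)     (zero , zero)     = sym (proj₂ simple u)
      hom (zero , zero)     (zero , suc zero) = sym uv
      hom (zero , suc zero) (zero , zero)     = sym (adj-sym uv)
      hom (zero , suc zero) (zero , suc zero) = sym (proj₂ simple v)
      hom (zero , zero)     (suc j , b)       = sym (proj₁ (apart (j , b)))
      hom (zero , suc zero) (suc j , b)       = sym (proj₂ (apart (j , b)))
      hom (suc i , a) (zero , zero)           = sym (adj-sym (proj₁ (apart (i , a))))
      hom (suc i , a) (zero , suc zero)       = sym (adj-sym (proj₂ (apart (i , a))))
      hom (suc i , a) (suc j , b)             =
        trans (cong (_∧ not ⌊ a ≟ᶠ b ⌋) (⌊⌋-suc i j)) (proj₂ (proj₂ rec) (i , a) (j , b))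

  pK₂-free⇒no-matching : ∀ p → Free (pK₂ p) G → ¬ Matching p full-sub
  pK₂-free⇒no-matching p free M =
    let φ , _ , hom = matching-embedding p full-sub M in free (φ , preserving-injective (pK₂ p) φ hom separated , hom)
    where
      mate : Fin 2 → Fin 2
      mate zero       = suc zero
      mate (suc zero) = zero
      not-self : ∀ a → ⌊ a ≟ᶠ mate a ⌋ ≡ false
      not-self zero       = refl
      not-self (suc zero) = refl
      mate-unique : ∀ {a b} → ⌊ b ≟ᶠ mate a ⌋ ≡ false → a ≡ b
      mate-unique {zero}     {zero}     _ = refl
      mate-unique {suc zero} {suc zero} _ = refl
      mate-unique {zero}     {suc zero} ()
      mate-unique {suc zero} {zero}     ()
      reflexive : ∀ {m} (i : Fin m) → ⌊ i ≟ᶠ i ⌋ ≡ true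
      reflexive i with i ≟ᶠ i
      ... | yes _ = refl
      ... | no ne = ⊥-elim (ne refl)
      separated : ∀ w z → w ≡ z ⊎ Σ (Fin p × Fin 2) λ y → Adj (pK₂ p) w y ≢ Adj (pK₂ p) z y
      -- The other end of the edge has `(i , a)` as its only neighbour, hence it separates this
      -- vertex from all others.
      separated (i , a) (j , b) with bool-dec (Adj (pK₂ p) (j , b) (i , mate a))
      ... | inj₁ t = let ji , ba = ∧-elim {⌊ j ≟ᶠ i ⌋} t in
            inj₁ (cong₂ _,_ (sym (⌊⌋-elim ji)) (mate-unique (not-elim ba)))
      ... | inj₂ f = inj₂ ((i , mate a) , λ e →
            true≢false (∧-intro (reflexive i) (not-intro (not-self a))) (trans e f))

  Clique⇒HasClique : ∀ {m S} → Clique m S → HasClique G m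
  Clique⇒HasClique (φ , _ , φ~) = φ , injective , φ~
    where
      injective : Injective _≡_ _≡_ φ
      injective {i} {j} e with i ≟ᶠ j
      ... | yes i≡j = i≡j
      ... | no i≢j  = ⊥-elim (adj-irrefl (φ~ i j i≢j) e)

  Colourable⇒χ≤ : ∀ {k} → Colourable full-sub k → χ≤ G k
  Colourable⇒χ≤ (c , c< , proper) = (λ v → fromℕ< (c< v refl)) ,
    λ u v uv e → proper u v refl refl uv (fromℕ<-injective _ _ (c< u refl) (c< v refl) e)

theorem3p6 : (p : ℕ) → 2 ≤ p → (n : ℕ) (G : Graph (Fin n)) → IsSimple G →
    Free (pK₂ p) G → Free HVN G →
    (w : ℕ) → CliqueNumber G w → χ≤ G (f p w)
theorem3p6 (suc (suc p)) (s≤s (s≤s z≤n)) n G simple noMatching noHVN w (_ , noClique) =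
  Colourable⇒χ≤ (Colourable-mono (g≤f p w)
    (bound (HVN-free⇒avoiding noHVN) p w full-sub (noClique ∘ Clique⇒HasClique {S = full-sub}) (pK₂-free⇒no-matching _ noMatching)))
  where
    open Graphs G simple
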